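{- For every $C,D\in\mathbb{B}^{\ell\times m}$, there exists a Presburger formula $\textsf{COMP-REG}_{C,D}(\bar X)$ with $\bar X=(X_1,\dots,X_m)$ such that for all $\bar N\in\mathbb{N}^m$: there exists a $(C,D)$-complete-regular digraph of size $\bar N$ if and only if $\textsf{COMP-REG}_{C,D}(\bar N)$ holds.
   Context: A Presburger formula is a first-order formula with $+,\le,0,1$ interpreted over $\mathbb{N}=\{0,1,2,\dots\}$. Let $\mathbb{B}=\mathbb{N}\cup\{{\ge}d\mid d\in\mathbb{N}\}$, where "$x={\ge}d$" means $x\ge d$. An $\ell$-type digraph is $G=(V,E_1,\dots,E_\ell)$ where $E_1,\dots,E_\ell$ are pairwise disjoint irreflexive binary relations on $V$ such that if $(u,v)\in E_1\cup\dots\cup E_\ell$ then $(v,u)\notin E_1\cup\dots\cup E_\ell$. $G$ is a $(C,D)$-regular-digraph if there is a partition $V=V_1\cup\dots\cup V_m$ (parts may be empty) such that for all $i,j$ and $v\in V_j$: $\textrm{in-deg}_{E_i}(v)=C_{i,j}$ and $\textrm{out-deg}_{E_i}(v)=D_{i,j}$; it has size $\bar N$ if the partition can be chosen with $\bar N=(|V_1|,\dots,|V_m|)$. $G$ is complete if for every two distinct vertices $u,v$, either $(u,v)$ or $(v,u)$ lies in $E_1\cup\dots\cup E_\ell$; a $(C,D)$-complete-regular digraph is a complete $(C,D)$-regular-digraph. -}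

module Defs where

open import Data.Nat using (ℕ; zero; suc; _+_; _≤_)
open import Data.Fin using (Fin; zero; suc)
open import Data.Bool using (Bool; true; false)
open import Data.Product using (Σ; ∃; _×_; _,_)
open import Data.Sum using (_⊎_)
open import Data.Unit using (⊤)
open import Data.Empty using (⊥)
open import Relation.Nullary using (¬_)
open import Relation.Binary.PropositionalEquality using (_≡_)

data 𝔹 : Set where
  exactly : ℕ → 𝔹
  atLeast : ℕ → 𝔹

_≐_ : ℕ → 𝔹 → Set
x ≐ exactly d = x ≡ d
x ≐ atLeast d = d ≤ x

data Term (n : ℕ) : Set where
  var  : Fin n → Term n
  𝟘    : Term n
  𝟙    : Term n
  _⊕_  : Term n → Term n → Term n

data Formula (n : ℕ) : Set where
  tt ff  : Formula n
  _≤′_   : Term n → Term n → Formula n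
  _≡′_   : Term n → Term n → Formula n
  ¬′_    : Formula n → Formula n
  _∧′_   : Formula n → Formula n → Formula n
  _∨′_   : Formula n → Formula n → Formula n
  _⇒′_   : Formula n → Formula n → Formula n
  ∃′     : Formula (suc n) → Formula n
  ∀′     : Formula (suc n) → Formula n

extend : ∀ {n} → ℕ → (Fin n → ℕ) → Fin (suc n) → ℕ
extend x ρ zero    = x
extend x ρ (suc i) = ρ i

⟦_⟧t : ∀ {n} → Term n → (Fin n → ℕ) → ℕ
⟦ var i ⟧t ρ = ρ i
⟦ 𝟘 ⟧t ρ = 0
⟦ 𝟙 ⟧t ρ = 1
⟦ s ⊕ t ⟧t ρ = ⟦ s ⟧t ρ + ⟦ t ⟧t ρ

⟦_⟧ : ∀ {n} → Formula n → (Fin n → ℕ) → Set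
⟦ tt ⟧ ρ = ⊤
⟦ ff ⟧ ρ = ⊥
⟦ s ≤′ t ⟧ ρ = ⟦ s ⟧t ρ ≤ ⟦ t ⟧t ρ
⟦ s ≡′ t ⟧ ρ = ⟦ s ⟧t ρ ≡ ⟦ t ⟧t ρ
⟦ ¬′ φ ⟧ ρ = ¬ ⟦ φ ⟧ ρ
⟦ φ ∧′ ψ ⟧ ρ = ⟦ φ ⟧ ρ × ⟦ ψ ⟧ ρ
⟦ φ ∨′ ψ ⟧ ρ = ⟦ φ ⟧ ρ ⊎ ⟦ ψ ⟧ ρ
⟦ φ ⇒′ ψ ⟧ ρ = ⟦ φ ⟧ ρ → ⟦ ψ ⟧ ρ
⟦ ∃′ φ ⟧ ρ = Σ ℕ λ x → ⟦ φ ⟧ (extend x ρ)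
⟦ ∀′ φ ⟧ ρ = (x : ℕ) → ⟦ φ ⟧ (extend x ρ)

count : ∀ {n} → (Fin n → Bool) → ℕ
count {zero}  p = 0
count {suc n} p with p zero
... | true  = suc (count (λ i → p (suc i)))
... | false = count (λ i → p (suc i))

record Digraph (ℓ n : ℕ) : Set where
  field
    E : Fin ℓ → Fin n → Fin n → Bool
    irreflexive : ∀ i v → E i v v ≡ false
    disjoint    : ∀ i j u v → E i u v ≡ true → E j u v ≡ true → i ≡ j
    asymmetric  : ∀ i j u v → E i u v ≡ true → E j v u ≡ false

open Digraph public

in-deg : ∀ {ℓ n} → Digraph ℓ n → Fin ℓ → Fin n → ℕ
in-deg G i v = count (λ u → E G i u v)

out-deg : ∀ {ℓ n} → Digraph ℓ n → Fin ℓ → Fin n → ℕ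
out-deg G i v = count (λ w → E G i v w)

Complete : ∀ {ℓ n} → Digraph ℓ n → Set
Complete {ℓ} G = ∀ u v → ¬ (u ≡ v) →
  Σ (Fin ℓ) λ i → (E G i u v ≡ true) ⊎ (E G i v u ≡ true)

_==ᶠ_ : ∀ {m} → Fin m → Fin m → Bool
zero  ==ᶠ zero  = true
zero  ==ᶠ suc _ = false
suc _ ==ᶠ zero  = false
suc i ==ᶠ suc j = i ==ᶠ j

-- G is a (C,D)-regular digraph of size N, witnessed by a partition
-- part : V → Fin m  (V_j = part⁻¹(j), possibly empty).
IsRegularOfSize : ∀ {ℓ m n} → (C D : Fin ℓ → Fin m → 𝔹) →
                  (N : Fin m → ℕ) → Digraph ℓ n → Set
IsRegularOfSize {ℓ} {m} {n} C D N G =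
  Σ (Fin n → Fin m) λ part →
    (∀ j → count (λ v → part v ==ᶠ j) ≡ N j) ×
    (∀ i v → (in-deg G i v ≐ C i (part v)) × (out-deg G i v ≐ D i (part v)))

ExistsCompleteRegular : ∀ {ℓ m} → (C D : Fin ℓ → Fin m → 𝔹) →
                        (N : Fin m → ℕ) → Set
ExistsCompleteRegular {ℓ} C D N =
  Σ ℕ λ n → Σ (Digraph ℓ n) λ G → Complete G × IsRegularOfSize C D N G

{-# OPTIONS --safe #-}

-- Every vertex sees each of its edges under one of 2ℓ labels (a colour and a direction), and its demand for a label is
-- either exact or "at least" (the label is large there). Deleting a vertex v splits the classes according to the label
-- under which v is seen, and lowers the demands by one accordingly, so "after deleting v the rest is realisable" is again
-- an existential Presburger condition. It therefore suffices to treat instances in which every original class is empty or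
-- has at least M vertices and every label has total demand 0 or at least L, for constants M and L: a vertex violating this
-- can be deleted, and a bounded potential drops each time.
--
-- In such an instance a complete graph exists iff (1) for every label t, some vertex is large for t or the total demand
-- for t covers that for its inverse, and (2) any two nonempty classes share a label that is large at both ends. Necessity
-- is double counting. For sufficiency, pair up the stubs of each colour and remove parallel edges by switching (L provides
-- enough edges to switch with), join the surplus stubs greedily to large vertices (M provides enough of them), and give all
-- remaining pairs a label that is large at both ends.

module Submission where

open import Defs
open import Data.Nat using (ℕ; zero; suc; _+_; _*_; _∸_; _⊓_; _≤_; _<_; z≤n; s≤s; _≤?_; _<?_)
open import Data.Nat.Properties hiding (_≟_)
open import Data.Nat.Tactic.RingSolver using (solve-∀)
open import Data.Fin using (Fin; zero; suc; _↑ˡ_; _↑ʳ_; splitAt; combine; remQuot; punchIn; lift; toℕ; fromℕ<)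
import Data.Fin.Properties as FinP
open import Data.Fin.Properties using (_≟_; any?)
open import Data.Fin.Permutation using (Permutation; _⟨$⟩ʳ_; transpose)
import Data.Bool as Bool
open import Data.Bool using (Bool; true; false; not)
import Data.Maybe as Maybe
open import Data.Maybe using (Maybe; just; nothing; _<∣>_)
open import Data.Maybe.Properties using (just-injective)
import Data.Product as Product
open import Data.Product using (Σ; _×_; _,_; proj₁; proj₂)
import Data.Sum as Sum
open import Data.Sum using (_⊎_; inj₁; inj₂; [_,_]′)
open import Function using (_∘_)
open import Function.Bundles using (_⇔_; mk⇔)
open import Relation.Nullary using (¬_; Dec; yes; no; contradiction)
open import Relation.Nullary.Decidable using (_×-dec_; _⊎-dec_)
open import Relation.Binary.Definitions using (tri<; tri≈; tri>)
open import Relation.Binary.PropositionalEquality hiding ([_])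
import Algebra.Properties.Semiring.Sum

-- The constants must survive the recursion. Each deletion multiplies the number of classes by the
-- number of labels, so thresholds cannot refer to the current classes. Instead a class remembers
-- its original class, largeness depends on that class alone, and demands only decrease. One bound
-- `K` on demands, and with it `M` and `L`, then serves every level. The potential sums the original
-- class sizes truncated at `M` and the total demands truncated at `L`; it is at most
-- `κ * M + τ * L`, which fixes the depth of the formula independently of the graph.
--
-- Edges are placed against two obstacles. Pairing the stubs of a colour may create loops, parallel
-- edges, or edges on pairs occupied by earlier colours; a switch repairs one edge, and few partners
-- are bad for it because planted degrees are bounded. Surplus stubs go to vertices whose degree may
-- grow without bound, so a receiver might run out of free partners before its own surplus is
-- served. Hence the three-colouring: stubs are sent only to the next colour, edges are received
-- only from the previous one, and with three colours these differ.

module SumP = Algebra.Properties.Semiring.Sum +-*-semiring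

-- Finite sums

𝟏 : Bool → ℕ
𝟏 true  = 1
𝟏 false = 0

δ : ∀ {n} → Fin n → Fin n → ℕ
δ i j = 𝟏 (i ==ᶠ j)

==ᶠ-refl : ∀ {n} (i : Fin n) → (i ==ᶠ i) ≡ true
==ᶠ-refl zero    = refl
==ᶠ-refl (suc i) = ==ᶠ-refl i

==ᶠ-sound : ∀ {n} (i j : Fin n) → (i ==ᶠ j) ≡ true → i ≡ j
==ᶠ-sound zero    zero    _ = refl
==ᶠ-sound (suc i) (suc j) e = cong suc (==ᶠ-sound i j e)

δ-refl : ∀ {n} (i : Fin n) → δ i i ≡ 1
δ-refl i = cong 𝟏 (==ᶠ-refl i)

δ-≢ : ∀ {n} {i j : Fin n} → i ≢ j → δ i j ≡ 0
δ-≢ {i = i} {j} i≢j with i ==ᶠ j in e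
... | true  = contradiction (==ᶠ-sound i j e) i≢j
... | false = refl

δ⇒≡ : ∀ {n} {i j : Fin n} → 0 < δ i j → i ≡ j
δ⇒≡ {i = i} {j} p with i ==ᶠ j in e
... | true = ==ᶠ-sound i j e

δ-sym : ∀ {n} (i j : Fin n) → δ i j ≡ δ j i
δ-sym zero    zero    = refl
δ-sym zero    (suc j) = refl
δ-sym (suc i) zero    = refl
δ-sym (suc i) (suc j) = δ-sym i j

δ-injective : ∀ {m n} (f : Fin m → Fin n) → (∀ {i j} → f i ≡ f j → i ≡ j) →
              ∀ i j → δ (f i) (f j) ≡ δ i j
δ-injective f inj i j with i ≟ j
... | yes refl = trans (δ-refl (f i)) (sym (δ-refl i))
... | no i≢j   = trans (δ-≢ (i≢j ∘ inj)) (sym (δ-≢ i≢j))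

δ≤1 : ∀ {n} (i j : Fin n) → δ i j ≤ 1
δ≤1 i j with i ==ᶠ j
... | true  = ≤-refl
... | false = z≤n

-- Opaque, so that unification can read f off a goal about ∑ f.
opaque
  ∑ : ∀ {n} → (Fin n → ℕ) → ℕ
  ∑ = SumP.sum

  ∑-[] : (f : Fin 0 → ℕ) → ∑ f ≡ 0
  ∑-[] f = refl

  ∑-suc : ∀ {n} (f : Fin (suc n) → ℕ) → ∑ f ≡ f zero + ∑ (f ∘ suc)
  ∑-suc f = refl

  ∑-cong : ∀ {n} {f g : Fin n → ℕ} → (∀ i → f i ≡ g i) → ∑ f ≡ ∑ g
  ∑-cong = SumP.sum-cong-≗

  ∑-remove : ∀ {n} (f : Fin (suc n) → ℕ) i → ∑ f ≡ f i + ∑ (λ j → f (punchIn i j))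
  ∑-remove f i = SumP.sum-remove {i = i} f

  ∑-+ : ∀ {n} (f g : Fin n → ℕ) → ∑ (λ i → f i + g i) ≡ ∑ f + ∑ g
  ∑-+ = SumP.∑-distrib-+

  ∑-swap : ∀ {m n} (f : Fin m → Fin n → ℕ) → ∑ (λ i → ∑ (f i)) ≡ ∑ (λ j → ∑ (λ i → f i j))
  ∑-swap = SumP.∑-comm

  ∑-permute : ∀ {n} (f : Fin n → ℕ) (π : Permutation n n) → ∑ f ≡ ∑ (λ i → f (π ⟨$⟩ʳ i))
  ∑-permute = SumP.sum-permute

  ∑-*ˡ : ∀ {n} x (f : Fin n → ℕ) → x * ∑ f ≡ ∑ (λ i → x * f i)
  ∑-*ˡ = SumP.*-distribˡ-sum

  ∑-*ʳ : ∀ {n} x (f : Fin n → ℕ) → ∑ f * x ≡ ∑ (λ i → f i * x)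
  ∑-*ʳ = SumP.*-distribʳ-sum

  count≡∑ : ∀ {n} (p : Fin n → Bool) → count p ≡ ∑ (λ i → 𝟏 (p i))
  count≡∑ {zero}  p = refl
  count≡∑ {suc n} p with p zero
  ... | true  = cong suc (count≡∑ (p ∘ suc))
  ... | false = count≡∑ (p ∘ suc)

  ∑-mono : ∀ {n} {f g : Fin n → ℕ} → (∀ i → f i ≤ g i) → ∑ f ≤ ∑ g
  ∑-mono {zero}  f≤g = z≤n
  ∑-mono {suc n} f≤g = +-mono-≤ (f≤g zero) (∑-mono (f≤g ∘ suc))

  ∑-mono-< : ∀ {n} {f g : Fin n → ℕ} → (∀ i → f i ≤ g i) → ∀ i → f i < g i → ∑ f < ∑ g
  ∑-mono-< f≤g zero    p = +-mono-<-≤ p (∑-mono (f≤g ∘ suc))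
  ∑-mono-< f≤g (suc i) p = +-mono-≤-< (f≤g zero) (∑-mono-< (f≤g ∘ suc) i p)

  ∑-const : ∀ n c → ∑ {n} (λ _ → c) ≡ n * c
  ∑-const zero    c = refl
  ∑-const (suc n) c = cong (c +_) (∑-const n c)

  ∑-zero : ∀ {n} {f : Fin n → ℕ} → (∀ i → f i ≡ 0) → ∑ f ≡ 0
  ∑-zero {n} f≡0 = trans (∑-cong f≡0) (trans (∑-const n 0) (*-zeroʳ n))

  term≤∑ : ∀ {n} (f : Fin n → ℕ) i → f i ≤ ∑ f
  term≤∑ f zero    = m≤m+n _ _
  term≤∑ f (suc i) = ≤-trans (term≤∑ (f ∘ suc) i) (m≤n+m _ _)

  ∑-pigeonhole : ∀ {n} (f g : Fin n → ℕ) → ∑ f < ∑ g → Σ (Fin n) λ i → f i < g i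
  ∑-pigeonhole {suc n} f g p with f zero <? g zero
  ... | yes q = zero , q
  ... | no ¬q with ∑-pigeonhole (f ∘ suc) (g ∘ suc)
                    (+-cancelˡ-< (f zero) _ _ (<-≤-trans p (+-monoˡ-≤ _ (≮⇒≥ ¬q))))
  ...   | i , r = suc i , r

  ∑-positive : ∀ {n} (f : Fin n → ℕ) → 0 < ∑ f → Σ (Fin n) λ i → 0 < f i
  ∑-positive {n} f p = ∑-pigeonhole (λ _ → 0) f (subst (_< ∑ f) (sym (∑-zero {n} λ _ → refl)) p)

  ∑-δ : ∀ {n} (f : Fin n → ℕ) i → ∑ (λ j → f j * δ i j) ≡ f i
  ∑-δ {suc n} f zero = begin
    f zero * 1 + ∑ (λ j → f (suc j) * 0) ≡⟨ cong₂ _+_ (*-identityʳ _) (∑-zero λ j → *-zeroʳ (f (suc j))) ⟩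
    f zero + 0                             ≡⟨ +-identityʳ _ ⟩
    f zero                                 ∎
    where open ≡-Reasoning
  ∑-δ {suc n} f (suc i) = trans (cong (_+ ∑ (λ j → f (suc j) * δ i j)) (*-zeroʳ (f zero))) (∑-δ (f ∘ suc) i)

  ∑-δ₁ : ∀ {n} (i : Fin n) → ∑ (λ j → δ i j) ≡ 1
  ∑-δ₁ i = trans (∑-cong λ j → sym (*-identityˡ (δ i j))) (∑-δ (λ _ → 1) i)

  ∑-splitAt : ∀ a {b} (f : Fin (a + b) → ℕ) → ∑ f ≡ ∑ (λ i → f (i ↑ˡ b)) + ∑ (λ i → f (a ↑ʳ i))
  ∑-splitAt zero    f = refl
  ∑-splitAt (suc a) f = trans (cong (f zero +_) (∑-splitAt a (f ∘ suc))) (sym (+-assoc (f zero) _ _))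

-- Turns a sum over vertices into an expression linear in the class sizes, hence into a Presburger
-- term.
∑-fibres : ∀ {n m} (h : Fin n → Fin m) (f : Fin m → ℕ) →
             ∑ (λ v → f (h v)) ≡ ∑ (λ j → f j * ∑ (λ v → δ (h v) j))
∑-fibres h f = begin
  ∑ (λ v → f (h v))                        ≡⟨ ∑-cong (λ v → sym (∑-δ f (h v))) ⟩
  ∑ (λ v → ∑ (λ j → f j * δ (h v) j))    ≡⟨ ∑-swap _ ⟩
  ∑ (λ j → ∑ (λ v → f j * δ (h v) j))    ≡⟨ ∑-cong (λ j → sym (∑-*ˡ (f j) _)) ⟩
  ∑ (λ j → f j * ∑ (λ v → δ (h v) j))    ∎
  where open ≡-Reasoning

∑-fibres-≤ : ∀ {n m K} (h : Fin n → Fin m) → (∀ j → ∑ (λ v → δ (h v) j) ≤ K) →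
               (f : Fin m → ℕ) → ∑ (λ v → f (h v)) ≤ ∑ f * K
∑-fibres-≤ {K = K} h h≤K f = begin
  ∑ (λ v → f (h v))                      ≡⟨ ∑-fibres h f ⟩
  ∑ (λ j → f j * ∑ (λ v → δ (h v) j))  ≤⟨ ∑-mono (λ j → *-monoʳ-≤ (f j) (h≤K j)) ⟩
  ∑ (λ j → f j * K)                      ≡⟨ ∑-*ʳ K f ⟨
  ∑ f * K                                ∎
  where open ≤-Reasoning

fibres-total : ∀ {n m} (h : Fin n → Fin m) → ∑ (λ j → ∑ (λ v → δ (h v) j)) ≡ n
fibres-total {n} h = begin
  ∑ (λ j → ∑ (λ v → δ (h v) j))      ≡⟨ ∑-swap _ ⟩
  ∑ (λ v → ∑ (λ j → δ (h v) j))      ≡⟨ ∑-cong (λ v → ∑-δ₁ (h v)) ⟩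
  ∑ {n} (λ _ → 1)                    ≡⟨ ∑-const n 1 ⟩
  n * 1                              ≡⟨ *-identityʳ n ⟩
  n                                  ∎
  where open ≡-Reasoning

-- A multiset given by its multiplicities, laid out as a finite list. Besides vertex sets with
-- prescribed class sizes it supplies lists of stubs, where a vertex occurs as often as it has
-- demand.
Listing : ∀ {m} → (Fin m → ℕ) → Set
Listing {m} N = Σ ℕ λ n → Σ (Fin n → Fin m) λ part → ∀ j → ∑ (λ v → δ (part v) j) ≡ N j

listing : ∀ {m} (N : Fin m → ℕ) → Listing N
listing {zero}  N = 0 , (λ ()) , λ ()
listing {suc m} N with listing (N ∘ suc)
... | k , rest , rest-count = N zero + k , part , counts
  where
  glue : Fin (N zero) ⊎ Fin k → Fin (suc m)
  glue = [ (λ _ → zero) , (λ u → suc (rest u)) ]′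

  part : Fin (N zero + k) → Fin (suc m)
  part v = glue (splitAt (N zero) v)

  part-split : ∀ j → ∑ (λ v → δ (part v) j) ≡ N zero * δ zero j + ∑ (λ u → δ (suc (rest u)) j)
  part-split j = begin
    ∑ (λ v → δ (part v) j)
      ≡⟨ ∑-splitAt (N zero) (λ v → δ (part v) j) ⟩
    ∑ {N zero} (λ v → δ (part (v ↑ˡ _)) j) + ∑ (λ u → δ (part (N zero ↑ʳ u)) j)
      ≡⟨ cong₂ _+_ (∑-cong λ v → cong (λ x → δ (glue x) j) (FinP.splitAt-↑ˡ (N zero) v _))
                   (∑-cong λ u → cong (λ x → δ (glue x) j) (FinP.splitAt-↑ʳ (N zero) _ u)) ⟩
    ∑ {N zero} (λ _ → δ zero j) + ∑ (λ u → δ (suc (rest u)) j)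
      ≡⟨ cong (_+ ∑ (λ u → δ (suc (rest u)) j)) (∑-const (N zero) (δ zero j)) ⟩
    N zero * δ zero j + ∑ (λ u → δ (suc (rest u)) j) ∎
    where open ≡-Reasoning

  counts : ∀ j → ∑ (λ v → δ (part v) j) ≡ N j
  counts zero    = trans (part-split zero)
    (trans (cong₂ _+_ (*-identityʳ (N zero)) (∑-zero λ _ → refl)) (+-identityʳ (N zero)))
  counts (suc j) = trans (part-split (suc j))
    (trans (cong (_+ ∑ (λ u → δ (rest u) j)) (*-zeroʳ (N zero))) (rest-count j))

listing-length : ∀ {m} {N : Fin m → ℕ} (l : Listing N) → proj₁ l ≡ ∑ N
listing-length (n , part , counts) = trans (sym (fibres-total part)) (∑-cong counts)

-- Switching parallel edges away

data TransposeView {S} (p q e : Fin S) : Fin S → Set where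
  at-p  : e ≡ p → TransposeView p q e q
  at-q  : e ≢ p → e ≡ q → TransposeView p q e p
  other : e ≢ p → TransposeView p q e e

transpose-view : ∀ {S} (p q e : Fin S) → TransposeView p q e (transpose p q ⟨$⟩ʳ e)
transpose-view p q e with e ≟ p
... | yes e≡p = at-p e≡p
... | no  e≢p with e ≟ q
...   | yes e≡q = at-q e≢p e≡q
...   | no  e≢q = other e≢p

-- Both orientations count, because a pair of vertices carries a single label in all.
Parallel : ∀ {n S} → (src tgt : Fin S → Fin n) → Fin S → Fin S → Set
Parallel src tgt e e′ = (src e ≡ src e′ × tgt e ≡ tgt e′) ⊎ (src e ≡ tgt e′ × tgt e ≡ src e′)

-- A positive `F x y` forbids an edge between `x` and `y`, so `F-refl` rules out loops. `Q` bounds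
-- what is forbidden at one vertex, `K` the number of edges that start, or end, at it.
module Switching {n S : ℕ} (F : Fin n → Fin n → ℕ) (K Q : ℕ)
  (F-refl : ∀ x → 0 < F x x) (F-sym : ∀ x y → F x y ≡ F y x) (F-row : ∀ x → ∑ (F x) ≤ Q)
  (src : Fin S → Fin n) (src≤K : ∀ x → ∑ (λ e → δ (src e) x) ≤ K)
  where

  -- The repair runs through the indices in order: edges from `k` on may still be loops, forbidden
  -- or parallel.
  record SimpleBelow (k : ℕ) (tgt : Fin S → Fin n) : Set where
    field
      allowed     : ∀ e → toℕ e < k → F (src e) (tgt e) ≡ 0
      nonparallel : ∀ e e′ → toℕ e < k → toℕ e′ < k → e ≢ e′ → ¬ Parallel src tgt e e′

  module _ (tgt : Fin S → Fin n) (tgt≤K : ∀ x → ∑ (λ e → δ (tgt e) x) ≤ K) where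

    -- Zero means that `x` and `y` may be joined: the pair is not forbidden, and no edge of the
    -- whole list, repaired or not, joins them in either direction.
    near : Fin n → Fin n → ℕ
    near x y = F x y + ∑ (λ e → δ (src e) x * δ (tgt e) y + δ (tgt e) x * δ (src e) y)

    near-row : ∀ x → ∑ (near x) ≤ Q + (K + K)
    near-row x = begin
      ∑ (near x)
        ≡⟨ ∑-+ (F x) _ ⟩
      ∑ (F x) + ∑ (λ y → ∑ (λ e → δ (src e) x * δ (tgt e) y + δ (tgt e) x * δ (src e) y))
        ≡⟨ cong (∑ (F x) +_) (∑-swap _) ⟩
      ∑ (F x) + ∑ (λ e → ∑ (λ y → δ (src e) x * δ (tgt e) y + δ (tgt e) x * δ (src e) y))
        ≡⟨ cong (∑ (F x) +_) (∑-cong λ e → trans (∑-+ _ _) (cong₂ _+_ (∑-δ (λ _ → δ (src e) x) (tgt e)) (∑-δ (λ _ → δ (tgt e) x) (src e)))) ⟩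
      ∑ (F x) + ∑ (λ e → δ (src e) x + δ (tgt e) x)
        ≡⟨ cong (∑ (F x) +_) (∑-+ _ _) ⟩
      ∑ (F x) + (∑ (λ e → δ (src e) x) + ∑ (λ e → δ (tgt e) x))
        ≤⟨ +-mono-≤ (F-row x) (+-mono-≤ (src≤K x) (tgt≤K x)) ⟩
      Q + (K + K) ∎
      where open ≤-Reasoning

    far⇒allowed : ∀ {x y} → near x y ≡ 0 → F x y ≡ 0
    far⇒allowed {x} {y} = m+n≡0⇒m≡0 (F x y)

    private
      far-edge : ∀ {x y} → near x y ≡ 0 → ∀ e → δ (src e) x * δ (tgt e) y + δ (tgt e) x * δ (src e) y ≡ 0
      far-edge {x} {y} far e = n≤0⇒n≡0 (≤-trans (term≤∑ _ e) (≤-reflexive (m+n≡0⇒n≡0 (F x y) far)))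

    far⇒no-edge : ∀ {x y} → near x y ≡ 0 → ∀ e → ¬ (src e ≡ x × tgt e ≡ y)
    far⇒no-edge far e (refl , refl) with m+n≡0⇒m≡0 (δ (src e) (src e) * δ (tgt e) (tgt e)) (far-edge far e)
    ... | z rewrite δ-refl (src e) | δ-refl (tgt e) = contradiction z λ ()

    far⇒no-edge′ : ∀ {x y} → near x y ≡ 0 → ∀ e → ¬ (tgt e ≡ x × src e ≡ y)
    far⇒no-edge′ far e (refl , refl) with m+n≡0⇒n≡0 (δ (src e) (tgt e) * δ (tgt e) (src e)) (far-edge far e)
    ... | z rewrite δ-refl (src e) | δ-refl (tgt e) = contradiction z λ ()

    -- A bad `q` has its target near `src p` or its source near `tgt p`. A row of `near` sums to at
    -- most `Q + (K + K)`, and a vertex is the target, or the source, of at most `K` edges; each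
    -- alternative contributes one product.
    switch-partner : (Q + (K + K)) * K + (Q + (K + K)) * K < S → ∀ p →
      Σ (Fin S) λ q → near (src p) (tgt q) ≡ 0 × near (tgt p) (src q) ≡ 0
    switch-partner big p with ∑-pigeonhole (λ q → near (src p) (tgt q) + near (tgt p) (src q)) (λ _ → 1) few
      where
      open ≤-Reasoning
      few : ∑ (λ q → near (src p) (tgt q) + near (tgt p) (src q)) < ∑ {S} (λ _ → 1)
      few = begin-strict
        ∑ (λ q → near (src p) (tgt q) + near (tgt p) (src q))
          ≡⟨ ∑-+ _ _ ⟩
        ∑ (λ q → near (src p) (tgt q)) + ∑ (λ q → near (tgt p) (src q))
          ≤⟨ +-mono-≤ (∑-fibres-≤ tgt tgt≤K (near (src p))) (∑-fibres-≤ src src≤K (near (tgt p))) ⟩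
        ∑ (near (src p)) * K + ∑ (near (tgt p)) * K
          ≤⟨ +-mono-≤ (*-monoˡ-≤ K (near-row (src p))) (*-monoˡ-≤ K (near-row (tgt p))) ⟩
        (Q + (K + K)) * K + (Q + (K + K)) * K
          <⟨ big ⟩
        S ≡⟨ *-identityʳ S ⟨
        S * 1 ≡⟨ ∑-const S 1 ⟨
        ∑ {S} (λ _ → 1) ∎
    ... | q , none = q , m+n≡0⇒m≡0 _ (n<1⇒n≡0 none) , m+n≡0⇒n≡0 (near (src p) (tgt q)) (n<1⇒n≡0 none)

    -- The new edges join `src p` to `tgt q` and `src q` to `tgt p`. Neither pair is joined in the
    -- old list, so no kept edge is parallel to a new one.
    switch-simple : ∀ p q → near (src p) (tgt q) ≡ 0 → near (tgt p) (src q) ≡ 0 →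
      SimpleBelow (toℕ p) tgt → SimpleBelow (suc (toℕ p)) (λ e → tgt (transpose p q ⟨$⟩ʳ e))
    switch-simple p q far-p far-q simple = record { allowed = allowed′ ; nonparallel = nonparallel′ }
      where
      open SimpleBelow simple

      earlier : ∀ {e} → e ≢ p → toℕ e < suc (toℕ p) → toℕ e < toℕ p
      earlier e≢p (s≤s e≤p) = ≤∧≢⇒< e≤p (e≢p ∘ FinP.toℕ-injective)

      allowed′ : ∀ e → toℕ e < suc (toℕ p) → F (src e) (tgt (transpose p q ⟨$⟩ʳ e)) ≡ 0
      allowed′ e e≤p with transpose p q ⟨$⟩ʳ e | transpose-view p q e
      ... | _ | at-p refl = far⇒allowed far-p
      ... | _ | at-q _ refl = trans (F-sym (src q) (tgt p)) (far⇒allowed far-q)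
      ... | _ | other e≢p = allowed e (earlier e≢p e≤p)

      other≁p : ∀ e → ¬ ((src e ≡ src p × tgt e ≡ tgt q) ⊎ (src e ≡ tgt q × tgt e ≡ src p))
      other≁p e (inj₁ (a , b)) = far⇒no-edge far-p e (a , b)
      other≁p e (inj₂ (a , b)) = far⇒no-edge′ far-p e (b , a)

      other≁q : ∀ e → ¬ ((src e ≡ src q × tgt e ≡ tgt p) ⊎ (src e ≡ tgt p × tgt e ≡ src q))
      other≁q e (inj₁ (a , b)) = far⇒no-edge′ far-q e (b , a)
      other≁q e (inj₂ (a , b)) = far⇒no-edge far-q e (a , b)

      -- If the two new edges were parallel the same way round, the old edge `p` would already join
      -- `src p` to `tgt q`. If they were parallel in opposite directions, `q` would have been a
      -- loop, which `allowed` excludes since `q` precedes `p`.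
      p≁q : q ≢ p → toℕ q < suc (toℕ p) → ¬ ((src p ≡ src q × tgt q ≡ tgt p) ⊎ (src p ≡ tgt p × tgt q ≡ src q))
      p≁q q≢p q≤p (inj₁ (a , b)) = far⇒no-edge far-p p (refl , sym b)
      p≁q q≢p q≤p (inj₂ (a , b)) = <⇒≢ (F-refl (src q))
        (sym (trans (cong (F (src q)) (sym b)) (allowed q (earlier q≢p q≤p))))

      flip : ∀ {x y z w : Fin n} → (x ≡ z × y ≡ w) ⊎ (x ≡ w × y ≡ z) → (z ≡ x × w ≡ y) ⊎ (z ≡ y × w ≡ x)
      flip (inj₁ (a , b)) = inj₁ (sym a , sym b)
      flip (inj₂ (a , b)) = inj₂ (sym b , sym a)

      nonparallel′ : ∀ e e′ → toℕ e < suc (toℕ p) → toℕ e′ < suc (toℕ p) → e ≢ e′ →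
                     ¬ Parallel src (λ e → tgt (transpose p q ⟨$⟩ʳ e)) e e′
      nonparallel′ e e′ e≤p e′≤p e≢e′ par
        with transpose p q ⟨$⟩ʳ e | transpose-view p q e | transpose p q ⟨$⟩ʳ e′ | transpose-view p q e′
      ... | _ | at-p refl       | _ | at-p refl   = e≢e′ refl
      ... | _ | at-p refl       | _ | at-q q≢p refl = p≁q q≢p e′≤p par
      ... | _ | at-p refl       | _ | other _     = other≁p e′ (flip par)
      ... | _ | at-q q≢p refl   | _ | at-p refl   = p≁q q≢p e≤p (flip par)
      ... | _ | at-q _ refl     | _ | at-q _ refl = e≢e′ refl
      ... | _ | at-q _ refl     | _ | other _     = other≁q e′ (flip par)
      ... | _ | other _         | _ | at-p refl   = other≁p e par
      ... | _ | other _         | _ | at-q _ refl = other≁q e par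
      ... | _ | other e≢p       | _ | other e′≢p  =
        nonparallel e e′ (earlier e≢p e≤p) (earlier e′≢p e′≤p) e≢e′ par

  -- One switch per index. A switch permutes the targets, so the target counts, and with them the
  -- bound `K`, persist through all rounds. The case `S ≡ 0` serves labels without demand.
  switching : (S ≡ 0 ⊎ (Q + (K + K)) * K + (Q + (K + K)) * K < S) →
    (tgt : Fin S → Fin n) → (∀ x → ∑ (λ e → δ (tgt e) x) ≤ K) →
    Σ (Fin S → Fin n) λ tgt′ → (∀ x → ∑ (λ e → δ (tgt′ e) x) ≡ ∑ (λ e → δ (tgt e) x)) ×
      (∀ e → F (src e) (tgt′ e) ≡ 0) × (∀ e e′ → e ≢ e′ → ¬ Parallel src tgt′ e e′)
  switching size tgt tgt≤K = done (upto S ≤-refl)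
    where
    Upto : ℕ → Set
    Upto k = Σ (Fin S → Fin n) λ tgt′ → (∀ x → ∑ (λ e → δ (tgt′ e) x) ≡ ∑ (λ e → δ (tgt e) x)) × SimpleBelow k tgt′

    upto : ∀ k → k ≤ S → Upto k
    upto zero    _   = tgt , (λ _ → refl) , record { allowed = λ _ () ; nonparallel = λ _ _ () }
    upto (suc k) k<S with upto k (<⇒≤ k<S)
    ... | tgt₁ , same₁ , simple₁ = switched (switch-partner tgt₁ tgt₁≤K big p)
      where
      p = fromℕ< k<S

      tgt₁≤K : ∀ x → ∑ (λ e → δ (tgt₁ e) x) ≤ K
      tgt₁≤K x = subst (_≤ K) (sym (same₁ x)) (tgt≤K x)

      big : (Q + (K + K)) * K + (Q + (K + K)) * K < S
      big = [ (λ S≡0 → contradiction (subst (suc k ≤_) S≡0 k<S) λ ()) , (λ b → b) ]′ size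

      switched : (Σ (Fin S) λ q → near tgt₁ tgt₁≤K (src p) (tgt₁ q) ≡ 0 × near tgt₁ tgt₁≤K (tgt₁ p) (src q) ≡ 0) →
                 Upto (suc k)
      switched (q , far-p , far-q) =
        (λ e → tgt₁ (transpose p q ⟨$⟩ʳ e)) ,
        (λ x → trans (sym (∑-permute (λ e → δ (tgt₁ e) x) (transpose p q))) (same₁ x)) ,
        subst (λ j → SimpleBelow (suc j) (λ e → tgt₁ (transpose p q ⟨$⟩ʳ e))) (FinP.toℕ-fromℕ< k<S)
          (switch-simple tgt₁ tgt₁≤K p q far-p far-q
            (subst (λ j → SimpleBelow j tgt₁) (sym (FinP.toℕ-fromℕ< k<S)) simple₁))

    done : Upto S → _
    done (tgt′ , same , simple) = tgt′ , same , (λ e → allowed e (FinP.toℕ<n e)) ,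
      (λ e e′ → nonparallel e e′ (FinP.toℕ<n e) (FinP.toℕ<n e′))
      where open SimpleBelow simple

-- Partial labelled graphs

module Graphs {τ : ℕ} (inv : Fin τ → Fin τ) (inv-inv : ∀ t → inv (inv t) ≡ t) where

  inv-injective : ∀ {s t} → inv s ≡ inv t → s ≡ t
  inv-injective {s} {t} e = trans (sym (inv-inv s)) (trans (cong inv e) (inv-inv t))

  -- lab u w is the label under which u sees its edge to w; then w sees it under the inverse label.
  record PGraph (n : ℕ) : Set where
    field
      lab      : Fin n → Fin n → Maybe (Fin τ)
      loopless : ∀ v → lab v v ≡ nothing
      lab-inv  : ∀ u w → lab w u ≡ Maybe.map inv (lab u w)

  open PGraph public

  has : Fin τ → Maybe (Fin τ) → ℕ
  has t nothing  = 0
  has t (just s) = δ s t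

  used : Maybe (Fin τ) → ℕ
  used nothing  = 0
  used (just _) = 1

  deg : ∀ {n} → PGraph n → Fin τ → Fin n → ℕ
  deg G t u = ∑ (λ w → has t (lab G u w))

  has-inv : ∀ t x → has (inv t) (Maybe.map inv x) ≡ has t x
  has-inv t nothing  = refl
  has-inv t (just s) = δ-injective inv inv-injective s t

  ∑-has : ∀ x → ∑ (λ t → has t x) ≡ used x
  ∑-has nothing  = ∑-zero λ _ → refl
  ∑-has (just s) = ∑-δ₁ s

  used-map : ∀ x → used (Maybe.map inv x) ≡ used x
  used-map nothing  = refl
  used-map (just _) = refl

  ∑-deg : ∀ {n} (G : PGraph n) u → ∑ (λ t → deg G t u) ≡ ∑ (λ w → used (lab G u w))
  ∑-deg G u = trans (∑-swap _) (∑-cong λ w → ∑-has (lab G u w))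

  -- An edge seen under `t` from one end is seen under `inv t` from the other.
  handshake : ∀ {n} (G : PGraph n) t → ∑ (deg G t) ≡ ∑ (deg G (inv t))
  handshake G t = trans (∑-swap _) (∑-cong λ w → ∑-cong λ u →
    trans (sym (has-inv t (lab G u w))) (cong (has (inv t)) (sym (lab-inv G u w))))

  emptyGraph : ∀ {n} → PGraph n
  emptyGraph = record { lab = λ _ _ → nothing ; loopless = λ _ → refl ; lab-inv = λ _ _ → refl }

  deg-emptyGraph : ∀ {n} t (u : Fin n) → deg emptyGraph t u ≡ 0
  deg-emptyGraph t u = ∑-zero λ _ → refl

  -- Left-biased: `H` only labels pairs that are free in `G`, so a filler can be laid underneath a
  -- graph without disturbing it.
  overlay : ∀ {n} → PGraph n → PGraph n → PGraph n
  overlay G H = record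
    { lab      = λ u w → lab G u w <∣> lab H u w
    ; loopless = λ v → cong₂ _<∣>_ (loopless G v) (loopless H v)
    ; lab-inv  = λ u w → trans (cong₂ _<∣>_ (lab-inv G u w) (lab-inv H u w)) (map-<∣> (lab G u w) (lab H u w))
    }
    where
    map-<∣> : ∀ (x y : Maybe (Fin τ)) → (Maybe.map inv x <∣> Maybe.map inv y) ≡ Maybe.map inv (x <∣> y)
    map-<∣> nothing  y = refl
    map-<∣> (just _) y = refl

  module _ {n : ℕ} (u w : Fin n) (u≢w : u ≢ w) (t : Fin τ) where

    edge-lab : Fin n → Fin n → Maybe (Fin τ)
    edge-lab x y with x ≟ u | y ≟ w | x ≟ w | y ≟ u
    ... | yes _ | yes _ | _     | _     = just t
    ... | _     | _     | yes _ | yes _ = just (inv t)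
    ... | _     | _     | _     | _     = nothing

    edge : PGraph n
    edge = record { lab = edge-lab ; loopless = edge-loopless ; lab-inv = edge-lab-inv }
      where
      edge-loopless : ∀ v → edge-lab v v ≡ nothing
      edge-loopless v with v ≟ u | v ≟ w
      ... | yes refl | yes refl = contradiction refl u≢w
      ... | yes _    | no _     = refl
      ... | no _     | yes _    = refl
      ... | no _     | no _     = refl

      edge-lab-inv : ∀ x y → edge-lab y x ≡ Maybe.map inv (edge-lab x y)
      edge-lab-inv x y with x ≟ u | y ≟ w | x ≟ w | y ≟ u
      ... | yes refl | yes refl | yes refl | _        = contradiction refl u≢w
      ... | yes refl | yes refl | no _     | yes refl = contradiction refl u≢w
      ... | yes _    | yes _    | no _     | no _     = refl
      ... | yes refl | no _     | yes refl | _        = contradiction refl u≢w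
      ... | yes _    | no _     | no _     | yes _    = refl
      ... | yes _    | no _     | no _     | no _     = refl
      ... | no _     | yes refl | yes _    | yes refl = contradiction refl u≢w
      ... | no _     | yes _    | yes _    | no _     = refl
      ... | no _     | yes _    | no _     | yes _    = refl
      ... | no _     | yes _    | no _     | no _     = refl
      ... | no _     | no _     | yes _    | yes _    = cong just (sym (inv-inv t))
      ... | no _     | no _     | yes _    | no _     = refl
      ... | no _     | no _     | no _     | yes _    = refl
      ... | no _     | no _     | no _     | no _     = refl

    edge-lab-≢ : ∀ x y → ¬ (x ≡ u × y ≡ w) → ¬ (x ≡ w × y ≡ u) → edge-lab x y ≡ nothing
    edge-lab-≢ x y a b with x ≟ u | y ≟ w | x ≟ w | y ≟ u
    ... | yes p | yes q | _     | _     = contradiction (p , q) a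
    ... | yes _ | no _  | yes p | yes q = contradiction (p , q) b
    ... | yes _ | no _  | yes _ | no _  = refl
    ... | yes _ | no _  | no _  | _     = refl
    ... | no _  | _     | yes p | yes q = contradiction (p , q) b
    ... | no _  | _     | yes _ | no _  = refl
    ... | no _  | _     | no _  | _     = refl

    edge-lab-there : edge-lab u w ≡ just t
    edge-lab-there with u ≟ u | w ≟ w
    ... | yes _ | yes _  = refl
    ... | no ¬p | _      = contradiction refl ¬p
    ... | yes _ | no ¬p  = contradiction refl ¬p

    edge-lab-back : edge-lab w u ≡ just (inv t)
    edge-lab-back = trans (lab-inv edge u w) (cong (Maybe.map inv) edge-lab-there)

    module _ (G : PGraph n) (free : lab G u w ≡ nothing) where

      addEdge : PGraph n
      addEdge = overlay G edge

      private
        free-back : lab G w u ≡ nothing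
        free-back = trans (lab-inv G u w) (cong (Maybe.map inv) free)

        <∣>-nothing : ∀ (x : Maybe (Fin τ)) → (x <∣> nothing) ≡ x
        <∣>-nothing nothing  = refl
        <∣>-nothing (just _) = refl

      addEdge-≢ : ∀ x y → ¬ (x ≡ u × y ≡ w) → ¬ (x ≡ w × y ≡ u) → lab addEdge x y ≡ lab G x y
      addEdge-≢ x y a b = trans (cong (lab G x y <∣>_) (edge-lab-≢ x y a b)) (<∣>-nothing (lab G x y))

      -- The weight is left open because the lemma serves both degrees (`has s`) and the counting of
      -- occupied pairs (`used`).
      weight-addEdge : (φ : Maybe (Fin τ) → ℕ) → φ nothing ≡ 0 → ∀ x y →
        φ (lab addEdge x y) ≡ φ (lab G x y) + (φ (just t) * δ u x * δ w y + φ (just (inv t)) * δ w x * δ u y)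
      weight-addEdge φ φ0 x y = helper (x ≟ u) (y ≟ w) (x ≟ w) (y ≟ u)
        where
        there : φ (lab addEdge u w) ≡ φ (lab G u w) + (φ (just t) * δ u u * δ w w + φ (just (inv t)) * δ w u * δ u w)
        there rewrite free | edge-lab-there | φ0 | δ-refl u | δ-refl w | δ-≢ u≢w
                    | *-zeroʳ (φ (just (inv t)) * δ w u) = sym (trans (+-identityʳ _) (trans (*-identityʳ _) (*-identityʳ _)))

        back : φ (lab addEdge w u) ≡ φ (lab G w u) + (φ (just t) * δ u w * δ w u + φ (just (inv t)) * δ w w * δ u u)
        back rewrite free-back | edge-lab-back | φ0 | δ-refl u | δ-refl w | δ-≢ u≢w
                   | *-zeroʳ (φ (just t)) = sym (trans (*-identityʳ _) (*-identityʳ _))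

        product-zero : ∀ {i j i′ j′ : Fin n} c → ¬ (i′ ≡ i × j′ ≡ j) → c * δ i i′ * δ j j′ ≡ 0
        product-zero {i} {j} {i′} {j′} c ≢≢ with i′ ≟ i
        ... | yes refl = trans (cong (c * δ i i *_) (δ-≢ λ j≡j′ → ≢≢ (refl , sym j≡j′))) (*-zeroʳ (c * δ i i))
        ... | no i′≢i  = cong (_* δ j j′) (trans (cong (c *_) (δ-≢ (i′≢i ∘ sym))) (*-zeroʳ c))

        elsewhere : ¬ (x ≡ u × y ≡ w) → ¬ (x ≡ w × y ≡ u) →
          φ (lab addEdge x y) ≡ φ (lab G x y) + (φ (just t) * δ u x * δ w y + φ (just (inv t)) * δ w x * δ u y)
        elsewhere a b = trans (cong φ (addEdge-≢ x y a b)) (trans (sym (+-identityʳ _))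
          (cong (φ (lab G x y) +_) (sym (cong₂ _+_ (product-zero (φ (just t)) a) (product-zero (φ (just (inv t))) b)))))

        helper : Dec (x ≡ u) → Dec (y ≡ w) → Dec (x ≡ w) → Dec (y ≡ u) →
          φ (lab addEdge x y) ≡ φ (lab G x y) + (φ (just t) * δ u x * δ w y + φ (just (inv t)) * δ w x * δ u y)
        helper (yes refl) (yes refl) _ _ = there
        helper _ _ (yes refl) (yes refl) = back
        helper (no x≢u) _ (no x≢w) _ = elsewhere (x≢u ∘ proj₁) (x≢w ∘ proj₁)
        helper (no x≢u) _ (yes _) (no y≢u) = elsewhere (x≢u ∘ proj₁) (y≢u ∘ proj₂)
        helper (yes _) (no y≢w) (no x≢w) _ = elsewhere (y≢w ∘ proj₂) (x≢w ∘ proj₁)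
        helper (yes _) (no y≢w) (yes _) (no y≢u) = elsewhere (y≢w ∘ proj₂) (y≢u ∘ proj₂)

      deg-addEdge : ∀ s x → deg addEdge s x ≡ deg G s x + (δ t s * δ u x + δ (inv t) s * δ w x)
      deg-addEdge s x = begin
        deg addEdge s x
          ≡⟨ ∑-cong (λ y → weight-addEdge (has s) refl x y) ⟩
        ∑ (λ y → has s (lab G x y) + (δ t s * δ u x * δ w y + δ (inv t) s * δ w x * δ u y))
          ≡⟨ ∑-+ _ _ ⟩
        deg G s x + ∑ (λ y → δ t s * δ u x * δ w y + δ (inv t) s * δ w x * δ u y)
          ≡⟨ cong (deg G s x +_) (trans (∑-+ _ _) (cong₂ _+_ (∑-δ (λ _ → δ t s * δ u x) w) (∑-δ (λ _ → δ (inv t) s * δ w x) u))) ⟩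
        deg G s x + (δ t s * δ u x + δ (inv t) s * δ w x) ∎
        where open ≡-Reasoning

  record EdgesAdded {n S : ℕ} (G : PGraph n) (t : Fin τ) (src tgt : Fin S → Fin n) : Set where
    field
      graph    : PGraph n
      deg-grow : ∀ s x → deg graph s x ≡ deg G s x + (δ t s * ∑ (λ e → δ (src e) x) + δ (inv t) s * ∑ (λ e → δ (tgt e) x))

  addEdges : ∀ {n S} (G : PGraph n) t (src tgt : Fin S → Fin n) →
    (∀ e → src e ≢ tgt e) → (∀ e → lab G (src e) (tgt e) ≡ nothing) →
    (∀ e e′ → e ≢ e′ → ¬ Parallel src tgt e e′) → EdgesAdded G t src tgt
  addEdges {S = zero} G t src tgt _ _ _ = record { graph = G ; deg-grow = λ s x → sym (begin
      deg G s x + (δ t s * ∑ (λ e → δ (src e) x) + δ (inv t) s * ∑ (λ e → δ (tgt e) x))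
        ≡⟨ cong₂ (λ a b → deg G s x + (δ t s * a + δ (inv t) s * b)) (∑-[] _) (∑-[] _) ⟩
      deg G s x + (δ t s * 0 + δ (inv t) s * 0)
        ≡⟨ cong₂ (λ a b → deg G s x + (a + b)) (*-zeroʳ (δ t s)) (*-zeroʳ (δ (inv t) s)) ⟩
      deg G s x + 0
        ≡⟨ +-identityʳ _ ⟩
      deg G s x ∎) }
    where open ≡-Reasoning
  addEdges {S = suc S} G t src tgt proper free simple = record { graph = graph ; deg-grow = λ s x → begin
      deg graph s x
        ≡⟨ deg-grow s x ⟩
      deg G₁ s x + (δ t s * ∑ (λ e → δ (src (suc e)) x) + δ (inv t) s * ∑ (λ e → δ (tgt (suc e)) x))
        ≡⟨ cong (_+ (δ t s * ∑ (λ e → δ (src (suc e)) x) + δ (inv t) s * ∑ (λ e → δ (tgt (suc e)) x)))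
             (deg-addEdge (src zero) (tgt zero) (proper zero) t G (free zero) s x) ⟩
      deg G s x + (δ t s * δ (src zero) x + δ (inv t) s * δ (tgt zero) x)
        + (δ t s * ∑ (λ e → δ (src (suc e)) x) + δ (inv t) s * ∑ (λ e → δ (tgt (suc e)) x))
        ≡⟨ regroup (deg G s x) (δ t s) (δ (inv t) s) (δ (src zero) x) (δ (tgt zero) x) _ _ ⟩
      deg G s x + (δ t s * (δ (src zero) x + ∑ (λ e → δ (src (suc e)) x)) + δ (inv t) s * (δ (tgt zero) x + ∑ (λ e → δ (tgt (suc e)) x)))
        ≡⟨ cong₂ (λ a b → deg G s x + (δ t s * a + δ (inv t) s * b)) (∑-suc _) (∑-suc _) ⟨
      deg G s x + (δ t s * ∑ (λ e → δ (src e) x) + δ (inv t) s * ∑ (λ e → δ (tgt e) x)) ∎ }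
    where
    open ≡-Reasoning
    G₁ = addEdge (src zero) (tgt zero) (proper zero) t G (free zero)

    free₁ : ∀ e → lab G₁ (src (suc e)) (tgt (suc e)) ≡ nothing
    free₁ e = trans (addEdge-≢ (src zero) (tgt zero) (proper zero) t G (free zero) _ _
                (λ p → simple (suc e) zero (λ ()) (inj₁ p)) (λ p → simple (suc e) zero (λ ()) (inj₂ p))) (free (suc e))

    open EdgesAdded (addEdges G₁ t (src ∘ suc) (tgt ∘ suc) (proper ∘ suc) free₁
      (λ e e′ e≢e′ → simple (suc e) (suc e′) (e≢e′ ∘ FinP.suc-injective)))

    regroup : ∀ d a b p q x y → d + (a * p + b * q) + (a * x + b * y) ≡ d + (a * (p + x) + b * (q + y))
    regroup = solve-∀

-- Three-colouring with every class spread evenly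

next : Fin 3 → Fin 3
next zero             = suc zero
next (suc zero)       = suc (suc zero)
next (suc (suc zero)) = zero

next≢ : ∀ a → next a ≢ a
next≢ zero             ()
next≢ (suc zero)       ()
next≢ (suc (suc zero)) ()

next²≢ : ∀ a → next (next a) ≢ a
next²≢ zero             ()
next²≢ (suc zero)       ()
next²≢ (suc (suc zero)) ()

-- The number of steps of next from a to b.
lag : Fin 3 → Fin 3 → ℕ
lag a b = δ (next a) b + 2 * δ (next (next a)) b

lag≤2 : ∀ a b → lag a b ≤ 2
lag≤2 zero             zero             = z≤n
lag≤2 zero             (suc zero)       = s≤s z≤n
lag≤2 zero             (suc (suc zero)) = ≤-refl
lag≤2 (suc zero)       zero             = ≤-refl
lag≤2 (suc zero)       (suc zero)       = z≤n
lag≤2 (suc zero)       (suc (suc zero)) = s≤s z≤n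
lag≤2 (suc (suc zero)) zero             = s≤s z≤n
lag≤2 (suc (suc zero)) (suc zero)       = ≤-refl
lag≤2 (suc (suc zero)) (suc (suc zero)) = z≤n

-- A step of the cycle brings every colour one closer, except the colour just used, which becomes
-- two steps away.
lag-next : ∀ a b → suc (lag (next a) b) ≡ 3 * δ a b + lag a b
lag-next zero             zero             = refl
lag-next zero             (suc zero)       = refl
lag-next zero             (suc (suc zero)) = refl
lag-next (suc zero)       zero             = refl
lag-next (suc zero)       (suc zero)       = refl
lag-next (suc zero)       (suc (suc zero)) = refl
lag-next (suc (suc zero)) zero             = refl
lag-next (suc (suc zero)) (suc zero)       = refl
lag-next (suc (suc zero)) (suc (suc zero)) = refl

advance : ∀ {m} → Fin m → (Fin m → Fin 3) → Fin m → Fin 3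
advance o₀ f o with o ≟ o₀
... | yes _ = next (f o)
... | no _  = f o

-- The vertices of each class receive the colours cyclically; first o is the first colour used in class o.
cyclicColouring : ∀ {n m} (ob : Fin n → Fin m) (first : Fin m → Fin 3) → Σ (Fin n → Fin 3) λ c → ∀ o a →
  ∑ (λ v → δ (ob v) o) ≤ 3 * ∑ (λ v → δ (ob v) o * δ (c v) a) + lag (first o) a
cyclicColouring {zero} ob first = (λ ()) , λ o a → ≤-trans (≤-reflexive (∑-[] _)) z≤n
cyclicColouring {suc n} {m} ob first with cyclicColouring (ob ∘ suc) (advance (ob zero) first)
... | c′ , even = c , λ o a → subst₂ _≤_ (sym (∑-suc _)) (cong (λ x → 3 * x + lag (first o) a) (sym (∑-suc _))) (spread o a (even o a))
  where
  c : Fin (suc n) → Fin 3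
  c zero    = first (ob zero)
  c (suc v) = c′ v

  -- The lag accounts for the vertices of the class that come before its first one of colour `a`;
  -- from there on each vertex of colour `a` pays for itself and the next two.
  spread : ∀ o a {x y} → x ≤ 3 * y + lag (advance (ob zero) first o) a →
    δ (ob zero) o + x ≤ 3 * (δ (ob zero) o * δ (first (ob zero)) a + y) + lag (first o) a
  spread o a {x} {y} p with o ≟ ob zero
  ... | yes refl rewrite δ-refl (ob zero) = begin
    suc x                                                     ≤⟨ s≤s p ⟩
    suc (3 * y + lag (next (first o)) a)                      ≡⟨ +-suc (3 * y) _ ⟨
    3 * y + suc (lag (next (first o)) a)                      ≡⟨ cong (3 * y +_) (lag-next (first o) a) ⟩
    3 * y + (3 * δ (first o) a + lag (first o) a)             ≡⟨ regroup y (δ (first o) a) (lag (first o) a) ⟩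
    3 * (1 * δ (first o) a + y) + lag (first o) a             ∎
    where
    open ≤-Reasoning
    regroup : ∀ y d l → 3 * y + (3 * d + l) ≡ 3 * (1 * d + y) + l
    regroup = solve-∀
  ... | no o≢ rewrite δ-≢ (o≢ ∘ sym) = p

-- The `+ 2` covers the largest possible lag.
balancedColouring : ∀ {n m} (ob : Fin n → Fin m) → Σ (Fin n → Fin 3) λ c → ∀ o a q →
  3 * q + 2 ≤ ∑ (λ v → δ (ob v) o) → q ≤ ∑ (λ v → δ (ob v) o * δ (c v) a)
balancedColouring ob with cyclicColouring ob (λ _ → zero)
... | c , even = c , λ o a q large → *-cancelˡ-≤ 3 (+-cancelʳ-≤ 2 _ _
  (≤-trans large (≤-trans (even o a) (+-monoʳ-≤ _ (lag≤2 zero a)))))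

-- Planting the demanded edges

-- A colour is a pair of labels `t`, `inv t` (`colour-fibre`), and `out` chooses a representative of
-- each colour.
module Planting {τ ℓ : ℕ} (inv : Fin τ → Fin τ) (inv-inv : ∀ t → inv (inv t) ≡ t) (inv≢ : ∀ t → inv t ≢ t)
  (colour : Fin τ → Fin ℓ) (colour-fibre : ∀ s t → colour s ≡ colour t → s ≡ t ⊎ s ≡ inv t)
  (colour-inv : ∀ t → colour (inv t) ≡ colour t)
  (out : Fin ℓ → Fin τ) (colour-out : ∀ i → colour (out i) ≡ i) (K : ℕ)
  where

  open Graphs inv inv-inv

  -- One more than the number of bad partners in a switch, with row bound `suc (τ * K)`: one for the
  -- vertex itself and at most `τ * K` for the neighbours it already has.
  L : ℕ
  L = suc ((suc (τ * K) + (K + K)) * K + (suc (τ * K) + (K + K)) * K)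

  used≡0 : ∀ x → used x ≡ 0 → x ≡ nothing
  used≡0 nothing _ = refl

  module _ {n : ℕ} (dem : Fin n → Fin τ → ℕ) (dem≤K : ∀ u t → dem u t ≤ K) where

    tot : Fin τ → ℕ
    tot t = ∑ (λ u → dem u t)

    -- Large labels get no special treatment at this stage: every demand is accounted for with
    -- equality, and `rem` counts the stubs left over.
    record Planted : Set where
      field
        graph : PGraph n
        rem   : Fin τ → Fin n → ℕ
        exact : ∀ t u → deg graph t u + rem t u ≡ dem u t

    open Planted

    ∑-dem : ∀ u → ∑ (dem u) ≤ τ * K
    ∑-dem u = ≤-trans (∑-mono (dem≤K u)) (≤-reflexive (∑-const τ K))

    -- Stubs are left over only on the heavier side of a colour. This is what later guarantees a
    -- large vertex to receive them.
    Unmet : Planted → Fin τ → Set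
    Unmet P s = ∀ u → 0 < rem P s u → tot (inv s) < tot s

    record Step (P : Planted) (t : Fin τ) : Set where
      field
        result   : Planted
        unmet    : ∀ s → colour s ≡ colour t → Unmet result s
        untouched : ∀ s → colour s ≢ colour t → ∀ u → rem result s u ≡ rem P s u

    -- The stubs of the lighter label `t` are paired with as many stubs of `inv t`; the remainder of
    -- the longer list is what stays unmet. By `fresh` and `fresh′` no edge of this colour exists
    -- yet.
    plant-label : (P : Planted) (t : Fin τ) → (∀ u → rem P t u ≡ dem u t) → (∀ u → rem P (inv t) u ≡ dem u (inv t)) →
      tot t ≤ tot (inv t) → (tot t ≡ 0 ⊎ L ≤ tot t) → Step P t
    plant-label P t fresh fresh′ tot≤ size = from-listings (listing (λ u → dem u t)) (listing (λ u → dem u (inv t)))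
      where
      G = graph P

      untouched-deg : ∀ s u → rem P s u ≡ dem u s → deg G s u ≡ 0
      untouched-deg s u e = +-cancelʳ-≡ (rem P s u) _ _ (trans (exact P s u) (sym e))

      F : Fin n → Fin n → ℕ
      F x y = δ x y + used (lab G x y)

      F-row : ∀ x → ∑ (F x) ≤ suc (τ * K)
      F-row x = begin
        ∑ (F x)                                   ≡⟨ ∑-+ _ _ ⟩
        ∑ (δ x) + ∑ (λ y → used (lab G x y))      ≡⟨ cong₂ _+_ (∑-δ₁ x) (sym (∑-deg G x)) ⟩
        suc (∑ (λ s → deg G s x))                 ≤⟨ s≤s (∑-mono λ s → ≤-trans (m≤m+n _ _) (≤-reflexive (exact P s x))) ⟩
        suc (∑ (dem x))                           ≤⟨ s≤s (∑-dem x) ⟩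
        suc (τ * K)                               ∎
        where open ≤-Reasoning

      F-sym : ∀ x y → F x y ≡ F y x
      F-sym x y = cong₂ _+_ (δ-sym x y) (trans (sym (used-map (lab G x y))) (cong used (sym (lab-inv G x y))))

      F-refl : ∀ x → 0 < F x x
      F-refl x = ≤-trans (≤-reflexive (sym (δ-refl x))) (m≤m+n _ _)

      from-split : ∀ S r (src : Fin S → Fin n) (tgts : Fin (S + r) → Fin n) →
        S ≡ tot t → S + r ≡ tot (inv t) →
        (∀ u → ∑ (λ e → δ (src e) u) ≡ dem u t) → (∀ u → ∑ (λ e → δ (tgts e) u) ≡ dem u (inv t)) → Step P t
      from-split S r src tgts S≡ S+r≡ src-count tgts-count = planted (switching size′ tgt tgt≤K)
        where
        tgt : Fin S → Fin n
        tgt e = tgts (e ↑ˡ r)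

        spare : Fin n → ℕ
        spare u = ∑ (λ k → δ (tgts (S ↑ʳ k)) u)

        tgt+spare : ∀ u → ∑ (λ e → δ (tgt e) u) + spare u ≡ dem u (inv t)
        tgt+spare u = trans (sym (∑-splitAt S (λ e → δ (tgts e) u))) (tgts-count u)

        tgt≤K : ∀ u → ∑ (λ e → δ (tgt e) u) ≤ K
        tgt≤K u = ≤-trans (m≤m+n _ (spare u)) (≤-trans (≤-reflexive (tgt+spare u)) (dem≤K u (inv t)))

        open Switching F K (suc (τ * K)) F-refl F-sym F-row src
          (λ u → ≤-trans (≤-reflexive (src-count u)) (dem≤K u t))

        size′ : S ≡ 0 ⊎ L ≤ S
        size′ = subst (λ x → x ≡ 0 ⊎ L ≤ x) (sym S≡) size

        rem′ : Fin τ → Fin n → ℕ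
        rem′ s u with s ≟ t | s ≟ inv t
        ... | yes _ | _     = 0
        ... | no _  | yes _ = spare u
        ... | no _  | no _  = rem P s u

        planted : (Σ (Fin S → Fin n) λ tgt′ → (∀ x → ∑ (λ e → δ (tgt′ e) x) ≡ ∑ (λ e → δ (tgt e) x)) ×
                  (∀ e → F (src e) (tgt′ e) ≡ 0) × (∀ e e′ → e ≢ e′ → ¬ Parallel src tgt′ e e′)) → Step P t
        planted (tgt′ , same , allowed , simple) = record
          { result    = record { graph = graph′ ; rem = rem′ ; exact = exact′ }
          ; unmet     = unmet′
          ; untouched = untouched′
          }
          where
          proper : ∀ e → src e ≢ tgt′ e
          proper e p with m+n≡0⇒m≡0 (δ (src e) (tgt′ e)) (allowed e)
          ... | z = contradiction (trans (sym (δ-refl (src e))) (trans (cong (δ (src e)) p) z)) λ ()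

          open EdgesAdded (addEdges G t src tgt′ proper
            (λ e → used≡0 _ (m+n≡0⇒n≡0 (δ (src e) (tgt′ e)) (allowed e))) simple) renaming (graph to graph′)

          exact′ : ∀ s u → deg graph′ s u + rem′ s u ≡ dem u s
          exact′ s u with s ≟ t | s ≟ inv t
          ... | yes refl | _ rewrite deg-grow t u | untouched-deg t u (fresh u) | δ-refl t | δ-≢ (inv≢ t) | src-count u
            = trans (+-identityʳ _) (trans (+-identityʳ _) (+-identityʳ _))
          ... | no s≢t | yes refl rewrite deg-grow (inv t) u | untouched-deg (inv t) u (fresh′ u) | δ-refl (inv t) | δ-≢ (s≢t ∘ sym) | same u
            = trans (cong (_+ spare u) (+-identityʳ _)) (tgt+spare u)
          ... | no s≢t | no s≢t′ rewrite deg-grow s u | δ-≢ (s≢t ∘ sym) | δ-≢ (s≢t′ ∘ sym)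
            = trans (cong (_+ rem P s u) (+-identityʳ _)) (exact P s u)

          unmet′ : ∀ s → colour s ≡ colour t → ∀ u → 0 < rem′ s u → tot (inv s) < tot s
          unmet′ s s~t u pos with s ≟ t | s ≟ inv t
          ... | no s≢t | no s≢t′ = [ (λ e → contradiction e s≢t) , (λ e → contradiction e s≢t′) ]′ (colour-fibre s t s~t)
          ... | no _   | yes refl with ∑-positive _ pos
          ...   | k , _ = subst₂ _<_ (trans S≡ (cong tot (sym (inv-inv t)))) S+r≡
                            (m<m+n S (≤-<-trans z≤n (FinP.toℕ<n k)))

          untouched′ : ∀ s → colour s ≢ colour t → ∀ u → rem′ s u ≡ rem P s u
          untouched′ s s≁t u with s ≟ t | s ≟ inv t
          ... | yes refl | _        = contradiction refl s≁t
          ... | no _     | yes refl = contradiction (colour-inv t) s≁t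
          ... | no _     | no _     = refl

      from-listings : Listing (λ u → dem u t) → Listing (λ u → dem u (inv t)) → Step P t
      from-listings l@(S , src , src-count) l′@(S′ , tgts , tgts-count)
        with m≤n⇒∃[o]m+o≡n (subst₂ _≤_ (sym (listing-length l)) (sym (listing-length l′)) tot≤)
      ... | r , refl = from-split S r src tgts (listing-length l) (listing-length l′) src-count tgts-count

    module _ (size : ∀ t → tot t ≡ 0 ⊎ L ≤ tot t) where

      record Upto (k : ℕ) : Set where
        field
          planted : Planted
          done    : ∀ s → toℕ (colour s) < k → Unmet planted s
          fresh   : ∀ s → k ≤ toℕ (colour s) → ∀ u → rem planted s u ≡ dem u s

      open Upto

      plant-colours : ∀ k → k ≤ ℓ → Upto k
      plant-colours zero _ = record
        { planted = record { graph = emptyGraph ; rem = λ t u → dem u t ; exact = λ t u → cong (_+ dem u t) (deg-emptyGraph t u) }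
        ; done    = λ _ ()
        ; fresh   = λ _ _ _ → refl
        }
      plant-colours (suc k) k<ℓ = extend-by (≤-total (tot t) (tot (inv t)))
        where
        prev = plant-colours k (<⇒≤ k<ℓ)
        P = planted prev
        t = out (fromℕ< k<ℓ)

        index-t : toℕ (colour t) ≡ k
        index-t = trans (cong toℕ (colour-out _)) (FinP.toℕ-fromℕ< k<ℓ)

        fresh-t : ∀ s → colour s ≡ colour t → ∀ u → rem P s u ≡ dem u s
        fresh-t s s~t = fresh prev s (≤-reflexive (sym (trans (cong toℕ s~t) index-t)))

        finish : ∀ s → colour s ≡ colour t → Step P s → Upto (suc k)
        finish s₀ s₀~t st = record { planted = result ; done = done′ ; fresh = fresh″ }
          where
          open Step st

          done′ : ∀ s → toℕ (colour s) < suc k → Unmet result s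
          done′ s (s≤s s≤k) with colour s ≟ colour t
          ... | yes s~t = unmet s (trans s~t (sym s₀~t))
          ... | no s≁t  = λ u pos → done prev s (≤∧≢⇒< s≤k λ e → s≁t (FinP.toℕ-injective (trans e (sym index-t)))) u
                            (subst (0 <_) (untouched s (λ e → s≁t (trans e s₀~t)) u) pos)

          fresh″ : ∀ s → suc k ≤ toℕ (colour s) → ∀ u → rem result s u ≡ dem u s
          fresh″ s k<s u = trans (untouched s (λ e → <⇒≢ k<s (sym (trans (cong toℕ (trans e s₀~t)) index-t))) u)
                             (fresh prev s (<⇒≤ k<s) u)

        -- The source side must be the lighter label of the colour, so the representative chosen by
        -- `out` may have to be replaced by its inverse.
        extend-by : tot t ≤ tot (inv t) ⊎ tot (inv t) ≤ tot t → Upto (suc k)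
        extend-by (inj₁ t≤) = finish t refl
          (plant-label P t (fresh-t t refl) (fresh-t (inv t) (colour-inv t)) t≤ (size t))
        extend-by (inj₂ ≤t) = finish (inv t) (colour-inv t)
          (plant-label P (inv t) (fresh-t (inv t) (colour-inv t))
            (fresh-t (inv (inv t)) (trans (colour-inv (inv t)) (colour-inv t)))
            (subst (λ s → tot (inv t) ≤ tot s) (sym (inv-inv t)) ≤t) (size (inv t)))

      plant : Σ Planted λ P → ∀ s → Unmet P s
      plant = planted all , λ s → done all s (FinP.toℕ<n (colour s))
        where all = plant-colours ℓ ≤-refl

-- Absorbing surplus stubs, and completing the graph

Sat : Bool → ℕ → ℕ → Set
Sat true  d x = d ≤ x
Sat false d x = x ≡ d

δ-combine : ∀ {m n} (k : Fin (m * n)) (u : Fin m) (t : Fin n) →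
  δ k (combine u t) ≡ δ (proj₂ (remQuot {m} n k)) t * δ (proj₁ (remQuot {m} n k)) u
δ-combine {m} {n} k u t = trans (cong (λ x → δ x (combine u t)) (sym (FinP.combine-remQuot {m} n k)))
  (pairwise (proj₁ (remQuot {m} n k)) (proj₂ (remQuot {m} n k)))
  where
  pairwise : ∀ u′ t′ → δ (combine u′ t′) (combine u t) ≡ δ t′ t * δ u′ u
  pairwise u′ t′ with u′ ≟ u
  ... | yes refl = trans (δ-injective (combine u) (λ {i} {j} → FinP.combine-injectiveʳ u i u j) t′ t)
                     (sym (trans (cong (δ t′ t *_) (δ-refl u)) (*-identityʳ _)))
  ... | no u′≢u  = trans (δ-≢ (u′≢u ∘ FinP.combine-injectiveˡ u′ t′ u t))
                     (sym (trans (cong (δ t′ t *_) (δ-≢ u′≢u)) (*-zeroʳ (δ t′ t))))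

𝟏≤1 : ∀ b → 𝟏 b ≤ 1
𝟏≤1 true  = ≤-refl
𝟏≤1 false = z≤n

𝟏-positive : ∀ {b} → 0 < 𝟏 b → b ≡ true
𝟏-positive {true} _ = refl

*-positive : ∀ m {n} → 0 < m * n → 0 < m × 0 < n
*-positive (suc m) {zero}  p = contradiction (subst (0 <_) (*-zeroʳ m) p) λ ()
*-positive (suc m) {suc n} p = s≤s z≤n , s≤s z≤n

module Completion {τ : ℕ} (inv : Fin τ → Fin τ) (inv-inv : ∀ t → inv (inv t) ≡ t)
  {n : ℕ} (large : Fin n → Fin τ → Bool)
  where

  open Graphs inv inv-inv

  Total : ∀ {k} → PGraph k → Set
  Total G = ∀ u w → u ≢ w → Σ (Fin τ) λ t → lab G u w ≡ just t

  module _ (c : Fin n → Fin 3) (Q : ℕ)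
    (spread : ∀ s w → large w s ≡ true → ∀ a → Q ≤ ∑ (λ v → 𝟏 (large v s) * δ (c v) a))
    where

    -- A stub at u is only ever joined to a vertex of the next colour, so receiving does not increase load.
    ahead : Fin n → Fin n → ℕ
    ahead u w = δ (c w) (next (c u))

    load : PGraph n → Fin n → ℕ
    load G u = ∑ (λ w → ahead u w * used (lab G u w))

    surplus : ∀ {R} → (Fin R → Fin n) → (Fin R → Fin τ) → Fin τ → Fin n → ℕ
    surplus su st s u = ∑ (λ k → δ (st k) s * δ (su k) u)

    -- A receiver is large for the label it receives, so a degree overshoots only where a lower
    -- bound is demanded.
    record Absorbed {R : ℕ} (G : PGraph n) (su : Fin R → Fin n) (st : Fin R → Fin τ) : Set where
      field
        graph : PGraph n
        exact : ∀ s u → large u s ≡ false → deg graph s u ≡ deg G s u + surplus su st s u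
        lower : ∀ s u → deg G s u + surplus su st s u ≤ deg graph s u

    -- At least `Q` vertices of the next colour are large for `inv t`, while fewer than `Q` vertices
    -- of that colour are already joined to `u`.
    receiver : ∀ G u t → load G u < Q → Σ (Fin n) (λ w → large w (inv t) ≡ true) →
      Σ (Fin n) λ w → large w (inv t) ≡ true × c w ≡ next (c u) × lab G u w ≡ nothing
    receiver G u t room (w₀ , w₀-large)
      with ∑-pigeonhole _ _ (<-≤-trans room (spread (inv t) w₀ w₀-large (next (c u))))
    ... | w , lt = w , 𝟏-positive (proj₁ pos) , cw , free (lab G u w) lt
      where
      pos = *-positive (𝟏 (large w (inv t))) (≤-<-trans z≤n lt)
      cw  = δ⇒≡ (proj₂ pos)

      free : ∀ x → ahead u w * used x < 𝟏 (large w (inv t)) * ahead u w → x ≡ nothing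
      free nothing  _ = refl
      free (just s) p rewrite *-identityʳ (ahead u w) =
        contradiction (<-≤-trans p (≤-trans (*-monoˡ-≤ (ahead u w) (𝟏≤1 (large w (inv t)))) (≤-reflexive (+-identityʳ _)))) (<-irrefl refl)

    -- The bound on `load` plus waiting stubs is invariant: serving a stub of `u₀` raises the load
    -- of `u₀` by at most one, leaves `u₀` with one stub fewer, and raises no other load.
    absorb : ∀ R (su : Fin R → Fin n) (st : Fin R → Fin τ) (G : PGraph n) →
      (∀ k → Σ (Fin n) λ w → large w (inv (st k)) ≡ true) →
      (∀ u → load G u + ∑ (λ k → δ (su k) u) ≤ Q) → Absorbed G su st
    absorb zero su st G _ _ = record { graph = G ; exact = λ s u _ → sym (none s u) ; lower = λ s u → ≤-reflexive (none s u) }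
      where
      none : ∀ s u → deg G s u + surplus su st s u ≡ deg G s u
      none s u = trans (cong (deg G s u +_) (∑-[] _)) (+-identityʳ _)
    absorb (suc R) su st G need room = attach (receiver G u₀ t₀ room₀ (need zero))
      where
      u₀ = su zero
      t₀ = st zero

      room₀ : load G u₀ < Q
      room₀ = ≤-trans (≤-reflexive (+-comm 1 (load G u₀))) (≤-trans
        (+-monoʳ-≤ (load G u₀) (≤-trans (≤-reflexive (sym (δ-refl u₀))) (term≤∑ (λ k → δ (su k) u₀) zero))) (room u₀))

      attach : (Σ (Fin n) λ w → large w (inv t₀) ≡ true × c w ≡ next (c u₀) × lab G u₀ w ≡ nothing) → Absorbed G su st
      attach (w , w-large , cw , free) = record { graph = graph ; exact = exact′ ; lower = lower′ }
        where
        u₀≢w : u₀ ≢ w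
        u₀≢w e = next≢ (c u₀) (trans (sym cw) (cong c (sym e)))

        G₁ = addEdge u₀ w u₀≢w t₀ G free

        -- With two colours `u₀` would be ahead of `w`; the third colour keeps the received edge out
        -- of the load of `w`.
        w-not-ahead : ahead w u₀ ≡ 0
        w-not-ahead = δ-≢ λ e → next²≢ (c u₀) (trans (cong next (sym cw)) (sym e))

        load₁ : ∀ x → load G₁ x ≤ load G x + δ u₀ x
        load₁ x = begin
          load G₁ x
            ≡⟨ ∑-cong (λ y → trans (cong (ahead x y *_) (weight-addEdge u₀ w u₀≢w t₀ G free used refl x y))
                 (regroup (ahead x y) (used (lab G x y)) (δ u₀ x) (δ w y) (δ w x) (δ u₀ y))) ⟩
          ∑ (λ y → ahead x y * used (lab G x y) + (ahead x y * δ u₀ x * δ w y + ahead x y * δ w x * δ u₀ y))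
            ≡⟨ trans (∑-+ _ _) (cong (load G x +_) (∑-+ _ _)) ⟩
          load G x + (∑ (λ y → ahead x y * δ u₀ x * δ w y) + ∑ (λ y → ahead x y * δ w x * δ u₀ y))
            ≡⟨ cong₂ (λ a b → load G x + (a + b)) (∑-δ (λ y → ahead x y * δ u₀ x) w) (∑-δ (λ y → ahead x y * δ w x) u₀) ⟩
          load G x + (ahead x w * δ u₀ x + ahead x u₀ * δ w x)
            ≤⟨ +-monoʳ-≤ (load G x) (+-mono-≤ (≤-trans (*-monoˡ-≤ (δ u₀ x) (δ≤1 (c w) _)) (≤-reflexive (*-identityˡ _))) (≤-reflexive back)) ⟩
          load G x + (δ u₀ x + 0)
            ≡⟨ cong (load G x +_) (+-identityʳ _) ⟩
          load G x + δ u₀ x ∎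
          where
          open ≤-Reasoning
          regroup : ∀ a b p q r s → a * (b + (1 * p * q + 1 * r * s)) ≡ a * b + (a * p * q + a * r * s)
          regroup = solve-∀
          back : ahead x u₀ * δ w x ≡ 0
          back with w ≟ x
          ... | yes refl = cong (_* δ w w) w-not-ahead
          ... | no w≢x   = trans (cong (ahead x u₀ *_) (δ-≢ w≢x)) (*-zeroʳ (ahead x u₀))

        room₁ : ∀ u → load G₁ u + ∑ (λ k → δ (su (suc k)) u) ≤ Q
        room₁ u = ≤-trans (+-monoˡ-≤ _ (load₁ u)) (≤-trans
          (≤-reflexive (trans (+-assoc (load G u) _ _) (cong (load G u +_) (sym (∑-suc _))))) (room u))

        open Absorbed (absorb R (su ∘ suc) (st ∘ suc) G₁ (need ∘ suc) room₁)

        rest = surplus (su ∘ suc) (st ∘ suc)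

        grow : ∀ s u → deg G₁ s u + rest s u ≡ deg G s u + surplus su st s u + δ (inv t₀) s * δ w u
        grow s u = begin
          deg G₁ s u + rest s u
            ≡⟨ cong (_+ rest s u) (deg-addEdge u₀ w u₀≢w t₀ G free s u) ⟩
          deg G s u + (δ t₀ s * δ u₀ u + δ (inv t₀) s * δ w u) + rest s u
            ≡⟨ regroup (deg G s u) (δ t₀ s * δ u₀ u) (δ (inv t₀) s * δ w u) (rest s u) ⟩
          deg G s u + (δ t₀ s * δ u₀ u + rest s u) + δ (inv t₀) s * δ w u
            ≡⟨ cong (λ x → deg G s u + x + δ (inv t₀) s * δ w u) (∑-suc _) ⟨
          deg G s u + surplus su st s u + δ (inv t₀) s * δ w u ∎
          where
          open ≡-Reasoning
          regroup : ∀ a b c d → a + (b + c) + d ≡ a + (b + d) + c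
          regroup = solve-∀

        exact′ : ∀ s u → large u s ≡ false → deg graph s u ≡ deg G s u + surplus su st s u
        exact′ s u u-small = trans (exact s u u-small) (trans (grow s u)
          (trans (cong (deg G s u + surplus su st s u +_) unaffected) (+-identityʳ _)))
          where
          unaffected : δ (inv t₀) s * δ w u ≡ 0
          unaffected with inv t₀ ≟ s | w ≟ u
          ... | yes refl | yes refl = contradiction (trans (sym w-large) u-small) λ ()
          ... | yes refl | no w≢u   = trans (cong (δ (inv t₀) (inv t₀) *_) (δ-≢ w≢u)) (*-zeroʳ (δ (inv t₀) (inv t₀)))
          ... | no t≢s   | _        = cong (_* δ w u) (δ-≢ t≢s)

        lower′ : ∀ s u → deg G s u + surplus su st s u ≤ deg graph s u
        lower′ s u = ≤-trans (≤-trans (m≤m+n _ _) (≤-reflexive (sym (grow s u)))) (lower s u)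

  module _ (link : ∀ u w → Σ (Fin τ) λ t → large u t ≡ true × large w (inv t) ≡ true) where

    -- `link u w` and `link w u` may choose unrelated labels, so the smaller vertex of a pair
    -- decides for both.
    filler-lab : ∀ u w → Maybe (Fin τ)
    filler-lab u w with FinP.<-cmp u w
    ... | tri< _ _ _ = just (proj₁ (link u w))
    ... | tri≈ _ _ _ = nothing
    ... | tri> _ _ _ = just (inv (proj₁ (link w u)))

    filler : PGraph n
    filler = record { lab = filler-lab ; loopless = irreflexive′ ; lab-inv = symmetric′ }
      where
      irreflexive′ : ∀ v → filler-lab v v ≡ nothing
      irreflexive′ v with FinP.<-cmp v v
      ... | tri< _ n _ = contradiction refl n
      ... | tri≈ _ _ _ = refl
      ... | tri> _ n _ = contradiction refl n

      symmetric′ : ∀ u w → filler-lab w u ≡ Maybe.map inv (filler-lab u w)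
      symmetric′ u w with FinP.<-cmp u w | FinP.<-cmp w u
      ... | tri< _ _ _   | tri> _ _ _   = refl
      ... | tri≈ _ _ _   | tri≈ _ _ _   = refl
      ... | tri> _ _ _   | tri< _ _ _   = cong just (sym (inv-inv _))
      ... | tri< _ _ n   | tri< p _ _   = contradiction p n
      ... | tri< _ n _   | tri≈ _ p _   = contradiction (sym p) n
      ... | tri≈ _ p _   | tri< _ n _   = contradiction (sym p) n
      ... | tri≈ _ p _   | tri> _ n _   = contradiction (sym p) n
      ... | tri> _ n _   | tri≈ _ p _   = contradiction (sym p) n
      ... | tri> n _ _   | tri> _ _ p   = contradiction p n

    filler-large : ∀ u w t → filler-lab u w ≡ just t → large u t ≡ true
    filler-large u w t e with FinP.<-cmp u w
    filler-large u w _ refl | tri< _ _ _ = proj₁ (proj₂ (link u w))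
    filler-large u w _ refl | tri> _ _ _ = proj₂ (proj₂ (link w u))

    filler-total : Total filler
    filler-total u w u≢w with FinP.<-cmp u w
    ... | tri< _ _ _ = _ , refl
    ... | tri≈ _ p _ = contradiction p u≢w
    ... | tri> _ _ _ = _ , refl

    -- A label that is not large at `u` never occurs on the filler at `u`, so exact degrees remain
    -- those of `G`.
    complete : (G : PGraph n) (dem : Fin n → Fin τ → ℕ) →
      (∀ s u → large u s ≡ false → deg G s u ≡ dem u s) → (∀ s u → dem u s ≤ deg G s u) →
      Σ (PGraph n) λ H → Total H × (∀ t u → Sat (large u t) (dem u t) (deg H t u))
    complete G dem exact lower = H , total , sat
      where
      H = overlay G filler

      total : Total H
      total u w u≢w with lab G u w
      ... | just t  = t , refl
      ... | nothing = filler-total u w u≢w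

      sat : ∀ t u → Sat (large u t) (dem u t) (deg H t u)
      sat t u with large u t in e
      ... | true  = ≤-trans (lower t u) (∑-mono grows)
        where
        grows : ∀ w → has t (lab G u w) ≤ has t (lab H u w)
        grows w with lab G u w
        ... | just _  = ≤-refl
        ... | nothing = z≤n
      ... | false = trans (∑-cong unchanged) (exact t u e)
        where
        not-filler : ∀ w x → filler-lab u w ≡ x → has t x ≡ 0
        not-filler w nothing  _ = refl
        not-filler w (just s) p = δ-≢ λ s≡t → contradiction
          (trans (sym (filler-large u w t (trans p (cong just s≡t)))) e) λ ()

        unchanged : ∀ w → has t (lab H u w) ≡ has t (lab G u w)
        unchanged w with lab G u w
        ... | just _  = refl
        ... | nothing = not-filler w _ refl

-- Realisability when no class and no total demand is small

Sat⇒≤ : ∀ b {d x} → Sat b d x → d ≤ x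
Sat⇒≤ true  p = p
Sat⇒≤ false p = ≤-reflexive (sym p)

module Realisation {τ ℓ κ : ℕ} (inv : Fin τ → Fin τ) (inv-inv : ∀ t → inv (inv t) ≡ t) (inv≢ : ∀ t → inv t ≢ t)
  (colour : Fin τ → Fin ℓ) (colour-fibre : ∀ s t → colour s ≡ colour t → s ≡ t ⊎ s ≡ inv t)
  (colour-inv : ∀ t → colour (inv t) ≡ colour t)
  (out : Fin ℓ → Fin τ) (colour-out : ∀ i → colour (out i) ≡ i) (K : ℕ)
  (big : Fin κ → Fin τ → Bool)
  where

  open Graphs inv inv-inv
  open Planting inv inv-inv inv≢ colour colour-fibre colour-inv out colour-out K using (L; plant)
  module Plant = Planting inv inv-inv inv≢ colour colour-fibre colour-inv out colour-out K

  -- `Q` bounds the stubs of one vertex over all labels. A class of `M` vertices contains at least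
  -- `Q` of each of the three colours.
  Q M : ℕ
  Q = τ * K
  M = 3 * Q + 2

  Linked : Fin κ → Fin κ → Set
  Linked o o′ = Σ (Fin τ) λ t → big o t ≡ true × big o′ (inv t) ≡ true

  record Balanced (size : Fin κ → ℕ) (tot : Fin τ → ℕ) : Set where
    constructor balanced
    field
      sizes  : ∀ o → size o ≡ 0 ⊎ M ≤ size o
      totals : ∀ t → tot t ≡ 0 ⊎ L ≤ tot t

  -- `linkage` includes the case `o = o′`: pairs inside one class need a label that is large at both
  -- ends as well.
  record Consistent (size : Fin κ → ℕ) (tot absorbers : Fin τ → ℕ) : Set where
    constructor consistent
    field
      absorption : ∀ t → 0 < absorbers t ⊎ tot (inv t) ≤ tot t
      linkage    : ∀ o o′ → Linked o o′ ⊎ (size o ≡ 0 ⊎ size o′ ≡ 0)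

  module _ {n : ℕ} (ob : Fin n → Fin κ) (dem : Fin n → Fin τ → ℕ) where

    size : Fin κ → ℕ
    size o = ∑ (λ v → δ (ob v) o)

    total : Fin τ → ℕ
    total t = ∑ (λ v → dem v t)

    absorbers : Fin τ → ℕ
    absorbers t = ∑ (λ v → 𝟏 (big (ob v) t))

    large : Fin n → Fin τ → Bool
    large v = big (ob v)

    open Completion inv inv-inv large

    Realised : PGraph n → Set
    Realised H = Total H × (∀ t u → Sat (large u t) (dem u t) (deg H t u))

    occupied : ∀ v → size (ob v) ≢ 0
    occupied v = >⇒≢ (≤-trans (≤-reflexive (sym (δ-refl (ob v)))) (term≤∑ (λ u → δ (ob u) (ob v)) v))

    module _ (dem≤K : ∀ u t → dem u t ≤ K) where

      realise : Balanced size total → Consistent size total absorbers → Σ (PGraph n) Realised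
      realise (balanced sizes totals) (consistent absorption linkage) =
        complete link graph dem
          (λ s u small → trans (exact s u small) (met s u))
          (λ s u → ≤-trans (≤-reflexive (sym (met s u))) (lower s u))
        where
        planting = plant dem dem≤K totals
        open Plant.Planted (proj₁ planting) renaming (graph to G; exact to G-exact)

        unmet : ∀ s u → 0 < rem s u → total (inv s) < total s
        unmet = proj₂ planting

        stubs = listing {n * τ} (λ k → rem (proj₂ (remQuot {n} τ k)) (proj₁ (remQuot {n} τ k)))
        R = proj₁ stubs

        stub : Fin R → Fin (n * τ)
        stub = proj₁ (proj₂ stubs)

        su : Fin R → Fin n
        su k = proj₁ (remQuot {n} τ (stub k))

        st : Fin R → Fin τ
        st k = proj₂ (remQuot {n} τ (stub k))

        stub-count : ∀ s u → ∑ (λ k → δ (st k) s * δ (su k) u) ≡ rem s u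
        stub-count s u = trans (∑-cong λ k → sym (δ-combine (stub k) u s)) (trans (proj₂ (proj₂ stubs) (combine u s))
          (cong (λ p → rem (proj₂ p) (proj₁ p)) (FinP.remQuot-combine u s)))

        coloured = balancedColouring ob
        c = proj₁ coloured

        -- Largeness depends only on the original class, so the whole class of `w` is large for `s`,
        -- and a nonempty class has at least `M` vertices.
        spread : ∀ s w → large w s ≡ true → ∀ a → Q ≤ ∑ (λ v → 𝟏 (large v s) * δ (c v) a)
        spread s w w-large a with sizes (ob w)
        ... | inj₁ empty = contradiction empty (occupied w)
        ... | inj₂ M≤    = ≤-trans (proj₂ coloured (ob w) a Q M≤) (∑-mono λ v → *-monoˡ-≤ (δ (c v) a) (same-class v))
          where
          same-class : ∀ v → δ (ob v) (ob w) ≤ 𝟏 (large v s)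
          same-class v with ob v ≟ ob w
          ... | yes e rewrite e | w-large = δ≤1 (ob w) (ob w)
          ... | no ≢  = ≤-trans (≤-reflexive (δ-≢ ≢)) z≤n

        -- A surplus at `s` requires `total (inv s) < total s`. This refutes the second alternative
        -- of `absorption` at `inv s`, so the first provides a large vertex.
        need : ∀ k → Σ (Fin n) λ w → large w (inv (st k)) ≡ true
        need k with absorption (inv (st k))
        ... | inj₂ t≤ = contradiction (unmet (st k) (su k) pos) (≤⇒≯ (subst (λ s → total s ≤ total (inv (st k))) (inv-inv (st k)) t≤))
          where
          pos : 0 < rem (st k) (su k)
          pos = ≤-trans (≤-reflexive (sym (cong₂ _*_ (δ-refl (st k)) (δ-refl (su k)))))
            (≤-trans (term≤∑ (λ k′ → δ (st k′) (st k) * δ (su k′) (su k)) k) (≤-reflexive (stub-count (st k) (su k))))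
        ... | inj₁ pos with ∑-positive _ pos
        ...   | w , p = w , 𝟏-positive p

        stubs-at : ∀ u → ∑ (λ k → δ (su k) u) ≡ ∑ (λ s → rem s u)
        stubs-at u = begin
          ∑ (λ k → δ (su k) u)                          ≡⟨ ∑-cong (λ k → sym (trans (sym (∑-*ʳ (δ (su k) u) (δ (st k))))
                                                              (trans (cong (_* δ (su k) u) (∑-δ₁ (st k))) (*-identityˡ _)))) ⟩
          ∑ (λ k → ∑ (λ s → δ (st k) s * δ (su k) u))   ≡⟨ ∑-swap _ ⟩
          ∑ (λ s → ∑ (λ k → δ (st k) s * δ (su k) u))   ≡⟨ ∑-cong (λ s → stub-count s u) ⟩
          ∑ (λ s → rem s u)                             ∎
          where open ≡-Reasoning

        -- Planted edges and surplus stubs at `u` together make up exactly its total demand, which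
        -- is at most `Q`.
        room : ∀ u → load c Q spread G u + ∑ (λ k → δ (su k) u) ≤ Q
        room u = begin
          load c Q spread G u + ∑ (λ k → δ (su k) u)
            ≤⟨ +-mono-≤ (∑-mono λ w → ≤-trans (*-monoˡ-≤ (used (lab G u w)) (δ≤1 (c w) _)) (≤-reflexive (*-identityˡ _))) (≤-reflexive (stubs-at u)) ⟩
          ∑ (λ w → used (lab G u w)) + ∑ (λ s → rem s u)
            ≡⟨ cong (_+ ∑ (λ s → rem s u)) (∑-deg G u) ⟨
          ∑ (λ s → deg G s u) + ∑ (λ s → rem s u)
            ≡⟨ ∑-+ _ _ ⟨
          ∑ (λ s → deg G s u + rem s u)
            ≡⟨ ∑-cong (λ s → G-exact s u) ⟩
          ∑ (dem u)
            ≤⟨ Plant.∑-dem dem dem≤K u ⟩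
          Q ∎
          where open ≤-Reasoning

        open Absorbed (absorb c Q spread R su st G need room)

        met : ∀ s u → deg G s u + ∑ (λ k → δ (st k) s * δ (su k) u) ≡ dem u s
        met s u = trans (cong (deg G s u +_) (stub-count s u)) (G-exact s u)

        link : ∀ u w → Linked (ob u) (ob w)
        link u w with linkage (ob u) (ob w)
        ... | inj₁ l         = l
        ... | inj₂ (inj₁ e) = contradiction e (occupied u)
        ... | inj₂ (inj₂ e) = contradiction e (occupied w)

      module _ (H : PGraph n) (H-total : Total H) (H-sat : ∀ t u → Sat (large u t) (dem u t) (deg H t u)) where

        -- If no vertex is large for `t`, all degrees for `t` are exact, and `handshake` compares
        -- them with the degrees for `inv t`.
        absorption-necessary : ∀ t → 0 < absorbers t ⊎ total (inv t) ≤ total t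
        absorption-necessary t with 0 <? absorbers t
        ... | yes p = inj₁ p
        ... | no ¬p = inj₂ (begin
          total (inv t)      ≤⟨ ∑-mono (λ v → Sat⇒≤ _ (H-sat (inv t) v)) ⟩
          ∑ (deg H (inv t))  ≡⟨ handshake H t ⟨
          ∑ (deg H t)        ≡⟨ ∑-cong exact ⟩
          total t            ∎)
          where
          open ≤-Reasoning
          exact : ∀ v → deg H t v ≡ dem v t
          exact v with large v t in e | H-sat t v
          ... | false | p = p
          ... | true  | _ = contradiction (≤-trans (≤-reflexive (cong 𝟏 (sym e))) (term≤∑ (λ v → 𝟏 (large v t)) v)) ¬p

        exact-degree : Fin n → ℕ
        exact-degree u = ∑ (λ w → ∑ (λ t → 𝟏 (not (large u t)) * has t (lab H u w)))

        exact-degree≤Q : ∀ u → exact-degree u ≤ Q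
        exact-degree≤Q u = begin
          exact-degree u
            ≡⟨ ∑-swap _ ⟩
          ∑ (λ t → ∑ (λ w → 𝟏 (not (large u t)) * has t (lab H u w)))
            ≤⟨ ∑-mono bound ⟩
          ∑ {τ} (λ _ → K)
            ≡⟨ ∑-const τ K ⟩
          Q ∎
          where
          open ≤-Reasoning
          bound : ∀ t → ∑ (λ w → 𝟏 (not (large u t)) * has t (lab H u w)) ≤ K
          bound t with large u t | H-sat t u
          ... | true  | _ = ≤-trans (≤-reflexive (∑-zero λ _ → refl)) z≤n
          ... | false | p = ≤-trans (≤-reflexive (trans (∑-cong λ w → *-identityˡ _) p)) (dem≤K u t)

        -- Without a label that is large on both sides, every edge between the classes is exact at one of its ends.
        pairs-bound : ∀ o o′ → ¬ Linked o o′ → size o * size o′ ≤ size o * suc Q + size o′ * Q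
        pairs-bound o o′ unlinked = begin
          size o * size o′
            ≡⟨ trans (∑-*ʳ (size o′) _) (∑-cong λ u → ∑-*ˡ (δ (ob u) o) _) ⟩
          ∑ (λ u → ∑ (λ w → δ (ob u) o * δ (ob w) o′))
            ≤⟨ ∑-mono (λ u → ∑-mono (λ w → pair u w)) ⟩
          ∑ (λ u → ∑ (λ w → δ (ob u) o * (δ u w + ex u w) + δ (ob w) o′ * ex w u))
            ≡⟨ ∑-cong (λ u → ∑-+ _ _) ⟩
          ∑ (λ u → ∑ (λ w → δ (ob u) o * (δ u w + ex u w)) + ∑ (λ w → δ (ob w) o′ * ex w u))
            ≡⟨ ∑-+ _ _ ⟩
          ∑ (λ u → ∑ (λ w → δ (ob u) o * (δ u w + ex u w))) + ∑ (λ u → ∑ (λ w → δ (ob w) o′ * ex w u))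
            ≡⟨ cong₂ _+_ (∑-cong λ u → trans (sym (∑-*ˡ (δ (ob u) o) _)) (cong (δ (ob u) o *_) (trans (∑-+ _ _) (cong (_+ exact-degree u) (∑-δ₁ u)))))
                         (trans (∑-swap _) (∑-cong λ w → sym (∑-*ˡ (δ (ob w) o′) _))) ⟩
          ∑ (λ u → δ (ob u) o * suc (exact-degree u)) + ∑ (λ w → δ (ob w) o′ * exact-degree w)
            ≤⟨ +-mono-≤ (∑-mono λ u → *-monoʳ-≤ (δ (ob u) o) (s≤s (exact-degree≤Q u))) (∑-mono λ w → *-monoʳ-≤ (δ (ob w) o′) (exact-degree≤Q w)) ⟩
          ∑ (λ u → δ (ob u) o * suc Q) + ∑ (λ w → δ (ob w) o′ * Q)
            ≡⟨ cong₂ _+_ (∑-*ʳ (suc Q) _) (∑-*ʳ Q _) ⟨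
          size o * suc Q + size o′ * Q ∎
          where
          open ≤-Reasoning
          ex : Fin n → Fin n → ℕ
          ex u w = ∑ (λ t → 𝟏 (not (large u t)) * has t (lab H u w))

          ex-positive : ∀ u w t → lab H u w ≡ just t → large u t ≡ false → 1 ≤ ex u w
          ex-positive u w t e small = ≤-trans (≤-reflexive (sym one)) (term≤∑ (λ s → 𝟏 (not (large u s)) * has s (lab H u w)) t)
            where
            one : 𝟏 (not (large u t)) * has t (lab H u w) ≡ 1
            one rewrite small | e | δ-refl t = refl

          edge-exact : ∀ u w → u ≢ w → ob u ≡ o → ob w ≡ o′ → 1 ≤ ex u w + ex w u
          edge-exact u w u≢w refl refl with H-total u w u≢w
          ... | t , e with large u t in lu | large w (inv t) in lw
          ...   | false | _     = ≤-trans (ex-positive u w t e lu) (m≤m+n _ _)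
          ...   | true  | false = ≤-trans (ex-positive w u (inv t) (trans (lab-inv H u w) (cong (Maybe.map inv) e)) lw) (m≤n+m _ (ex u w))
          ...   | true  | true  = contradiction (t , lu , lw) unlinked

          -- The summand `δ u w` pays for `u = w`, which carries no edge but is counted when
          -- `o = o′`. It turns one `Q` of `pairs-bound` into `suc Q`.
          pair : ∀ u w → δ (ob u) o * δ (ob w) o′ ≤ δ (ob u) o * (δ u w + ex u w) + δ (ob w) o′ * ex w u
          pair u w with ob u ≟ o | ob w ≟ o′
          ... | no ≢o | _      rewrite δ-≢ ≢o = z≤n
          ... | yes _ | no ≢o′ rewrite δ-≢ ≢o′ | *-zeroʳ (δ (ob u) o) = z≤n
          ... | yes e | yes e′ = one*one {d = δ u w} {ex u w} (trans (cong (λ x → δ x o) e) (δ-refl o)) (trans (cong (λ x → δ x o′) e′) (δ-refl o′)) (covered (u ≟ w))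
            where
            one*one : ∀ {a b d x y} → a ≡ 1 → b ≡ 1 → 1 ≤ d + (x + y) → a * b ≤ a * (d + x) + b * y
            one*one {d = d} {x} {y} refl refl p = subst (1 ≤_) (regroup d x y) p
              where
              regroup : ∀ d x y → d + (x + y) ≡ 1 * (d + x) + 1 * y
              regroup = solve-∀

            covered : Dec (u ≡ w) → 1 ≤ δ u w + (ex u w + ex w u)
            covered (yes refl) = ≤-trans (≤-reflexive (sym (δ-refl u))) (m≤m+n _ _)
            covered (no u≢w)   = ≤-trans (edge-exact u w u≢w e e′) (m≤n+m _ (δ u w))

        linkage-necessary : (∀ o → size o ≡ 0 ⊎ M ≤ size o) → ∀ o o′ → Linked o o′ ⊎ (size o ≡ 0 ⊎ size o′ ≡ 0)
        linkage-necessary sizes o o′ with any? (λ t → (big o t Bool.≟ true) ×-dec (big o′ (inv t) Bool.≟ true))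
        ... | yes l = inj₁ l
        ... | no ¬l with sizes o | sizes o′
        ...   | inj₁ e  | _       = inj₂ (inj₁ e)
        ...   | inj₂ _  | inj₁ e  = inj₂ (inj₂ e)
        ...   | inj₂ M≤ | inj₂ M≤′ = contradiction (pairs-bound o o′ ¬l) (<⇒≱ (product-large (size o) (size o′) M≤ M≤′))
          where
          2+2Q≤M : suc Q + suc Q ≤ M
          2+2Q≤M = ≤-trans (m≤m+n _ Q) (≤-reflexive (regroup Q))
            where
            regroup : ∀ q → suc q + suc q + q ≡ 3 * q + 2
            regroup = solve-∀

          -- Both factors are at least `2 * suc Q`, so each summand is at most half of the product,
          -- and the second is strictly less since it has `Q` in place of `suc Q`.
          product-large : ∀ a b → M ≤ a → M ≤ b → a * suc Q + b * Q < a * b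
          product-large a b M≤a M≤b = *-cancelˡ-< 2 _ _ (begin-strict
            2 * (a * suc Q + b * Q)                                <⟨ doubled ⟩
            a * (suc Q + suc Q) + (suc Q + suc Q) * b              ≤⟨ +-mono-≤ (*-monoʳ-≤ a (≤-trans 2+2Q≤M M≤b)) (*-monoˡ-≤ b (≤-trans 2+2Q≤M M≤a)) ⟩
            a * b + a * b                                          ≡⟨ cong (a * b +_) (sym (+-identityʳ (a * b))) ⟩
            2 * (a * b)                                            ∎)
            where
            open ≤-Reasoning
            regroup : ∀ a b q → 2 * (a * suc q + b * q) + (b + b) ≡ a * (suc q + suc q) + (suc q + suc q) * b
            regroup = solve-∀
            b>0 : 0 < b
            b>0 = ≤-trans (≤-trans (s≤s z≤n) 2+2Q≤M) M≤b
            doubled : 2 * (a * suc Q + b * Q) < a * (suc Q + suc Q) + (suc Q + suc Q) * b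
            doubled = ≤-trans (m<m+n _ (≤-trans b>0 (m≤m+n b b))) (≤-reflexive (regroup a b Q))

        necessary : (∀ o → size o ≡ 0 ⊎ M ≤ size o) → Consistent size total absorbers
        necessary sizes = consistent absorption-necessary (linkage-necessary sizes)

-- Presburger formulas

infixl 7 _·_
_·_ : ∀ {n} → ℕ → Term n → Term n
zero  · t = 𝟘
suc c · t = t ⊕ (c · t)

·-sem : ∀ {n} c (t : Term n) ρ → ⟦ c · t ⟧t ρ ≡ c * ⟦ t ⟧t ρ
·-sem zero    t ρ = refl
·-sem (suc c) t ρ = cong (⟦ t ⟧t ρ +_) (·-sem c t ρ)

numeral : ∀ {n} → ℕ → Term n
numeral c = c · 𝟙

numeral-sem : ∀ {n} c (ρ : Fin n → ℕ) → ⟦ numeral c ⟧t ρ ≡ c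
numeral-sem c ρ = trans (·-sem c 𝟙 ρ) (*-identityʳ c)

linear : ∀ {n k} → (Fin k → ℕ) → (Fin k → Fin n) → Term n
linear {k = zero}  a x = 𝟘
linear {k = suc k} a x = (a zero · var (x zero)) ⊕ linear (a ∘ suc) (x ∘ suc)

linear-sem : ∀ {n k} (a : Fin k → ℕ) (x : Fin k → Fin n) ρ → ⟦ linear a x ⟧t ρ ≡ ∑ (λ j → a j * ρ (x j))
linear-sem {k = zero}  a x ρ = sym (∑-[] _)
linear-sem {k = suc k} a x ρ = trans
  (cong₂ _+_ (·-sem (a zero) (var (x zero)) ρ) (linear-sem (a ∘ suc) (x ∘ suc) ρ)) (sym (∑-suc _))

⋀ : ∀ {n k} → (Fin k → Formula n) → Formula n
⋀ {k = zero}  φ = tt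
⋀ {k = suc k} φ = φ zero ∧′ ⋀ (φ ∘ suc)

⋀-elim : ∀ {n k} (φ : Fin k → Formula n) {ρ} → ⟦ ⋀ φ ⟧ ρ → ∀ i → ⟦ φ i ⟧ ρ
⋀-elim φ (p , _) zero    = p
⋀-elim φ (_ , q) (suc i) = ⋀-elim (φ ∘ suc) q i

⋀-intro : ∀ {n k} (φ : Fin k → Formula n) {ρ} → (∀ i → ⟦ φ i ⟧ ρ) → ⟦ ⋀ φ ⟧ ρ
⋀-intro {k = zero}  φ p = _
⋀-intro {k = suc k} φ p = p zero , ⋀-intro (φ ∘ suc) (p ∘ suc)

⋁ : ∀ {n k} → (Fin k → Formula n) → Formula n
⋁ {k = zero}  φ = ff
⋁ {k = suc k} φ = φ zero ∨′ ⋁ (φ ∘ suc)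

⋁-elim : ∀ {n k} (φ : Fin k → Formula n) {ρ} → ⟦ ⋁ φ ⟧ ρ → Σ (Fin k) λ i → ⟦ φ i ⟧ ρ
⋁-elim {k = suc k} φ (inj₁ p) = zero , p
⋁-elim {k = suc k} φ (inj₂ q) with ⋁-elim (φ ∘ suc) q
... | i , p = suc i , p

⋁-intro : ∀ {n k} (φ : Fin k → Formula n) {ρ} i → ⟦ φ i ⟧ ρ → ⟦ ⋁ φ ⟧ ρ
⋁-intro φ zero    p = inj₁ p
⋁-intro φ (suc i) p = inj₂ (⋁-intro (φ ∘ suc) i p)

renameT : ∀ {a b} → (Fin a → Fin b) → Term a → Term b
renameT f (var i) = var (f i)
renameT f 𝟘       = 𝟘
renameT f 𝟙       = 𝟙
renameT f (s ⊕ t) = renameT f s ⊕ renameT f t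

-- Lets the formula of the split instance, in `m * τ` variables, stand inside one that also speaks
-- of the `m` class sizes before the deletion.
rename : ∀ {a b} → (Fin a → Fin b) → Formula a → Formula b
rename f tt       = tt
rename f ff       = ff
rename f (s ≤′ t) = renameT f s ≤′ renameT f t
rename f (s ≡′ t) = renameT f s ≡′ renameT f t
rename f (¬′ φ)   = ¬′ rename f φ
rename f (φ ∧′ ψ) = rename f φ ∧′ rename f ψ
rename f (φ ∨′ ψ) = rename f φ ∨′ rename f ψ
rename f (φ ⇒′ ψ) = rename f φ ⇒′ rename f ψ
rename f (∃′ φ)   = ∃′ (rename (lift 1 f) φ)
rename f (∀′ φ)   = ∀′ (rename (lift 1 f) φ)

renameT-sem : ∀ {a b} (f : Fin a → Fin b) {σ ρ} → (∀ i → ρ (f i) ≡ σ i) → ∀ t → ⟦ renameT f t ⟧t ρ ≡ ⟦ t ⟧t σ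
renameT-sem f e (var i) = e i
renameT-sem f e 𝟘       = refl
renameT-sem f e 𝟙       = refl
renameT-sem f e (s ⊕ t) = cong₂ _+_ (renameT-sem f e s) (renameT-sem f e t)

extend-lift : ∀ {a b} (f : Fin a → Fin b) {σ ρ} → (∀ i → ρ (f i) ≡ σ i) → ∀ x i →
  extend x ρ (lift 1 f i) ≡ extend x σ i
extend-lift f e x zero    = refl
extend-lift f e x (suc i) = e i

-- σ is kept apart from ρ ∘ f because the two agree only pointwise under binders.
rename-sem : ∀ {a b} (f : Fin a → Fin b) {σ ρ} → (∀ i → ρ (f i) ≡ σ i) → ∀ φ →
  (⟦ rename f φ ⟧ ρ → ⟦ φ ⟧ σ) × (⟦ φ ⟧ σ → ⟦ rename f φ ⟧ ρ)
rename-sem f e tt = (λ p → p) , (λ p → p)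
rename-sem f e ff = (λ p → p) , (λ p → p)
rename-sem f e (s ≤′ t) =
  subst₂ _≤_ (renameT-sem f e s) (renameT-sem f e t) ,
  subst₂ _≤_ (sym (renameT-sem f e s)) (sym (renameT-sem f e t))
rename-sem f e (s ≡′ t) =
  subst₂ _≡_ (renameT-sem f e s) (renameT-sem f e t) ,
  subst₂ _≡_ (sym (renameT-sem f e s)) (sym (renameT-sem f e t))
rename-sem f e (¬′ φ) with rename-sem f e φ
... | to , from = (λ p q → p (from q)) , (λ p q → p (to q))
rename-sem f e (φ ∧′ ψ) with rename-sem f e φ | rename-sem f e ψ
... | to , from | to′ , from′ = Product.map to to′ , Product.map from from′
rename-sem f e (φ ∨′ ψ) with rename-sem f e φ | rename-sem f e ψ
... | to , from | to′ , from′ = Sum.map to to′ , Sum.map from from′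
rename-sem f e (φ ⇒′ ψ) with rename-sem f e φ | rename-sem f e ψ
... | to , from | to′ , from′ = (λ p q → to′ (p (from q))) , (λ p q → from′ (p (to q)))
rename-sem f e (∃′ φ) =
  (λ (x , p) → x , proj₁ (rename-sem (lift 1 f) (extend-lift f e x) φ) p) ,
  (λ (x , p) → x , proj₂ (rename-sem (lift 1 f) (extend-lift f e x) φ) p)
rename-sem f e (∀′ φ) =
  (λ p x → proj₁ (rename-sem (lift 1 f) (extend-lift f e x) φ) (p x)) ,
  (λ p x → proj₂ (rename-sem (lift 1 f) (extend-lift f e x) φ) (p x))

append : ∀ {k m} → (Fin k → ℕ) → (Fin m → ℕ) → Fin (k + m) → ℕ
append {zero}  N ρ = ρ
append {suc k} N ρ = extend (N zero) (append (N ∘ suc) ρ)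

append-↑ˡ : ∀ {k m} (N : Fin k → ℕ) (ρ : Fin m → ℕ) i → append N ρ (i ↑ˡ m) ≡ N i
append-↑ˡ N ρ zero    = refl
append-↑ˡ N ρ (suc i) = append-↑ˡ (N ∘ suc) ρ i

append-↑ʳ : ∀ {k m} (N : Fin k → ℕ) (ρ : Fin m → ℕ) j → append N ρ (k ↑ʳ j) ≡ ρ j
append-↑ʳ {zero}  N ρ j = refl
append-↑ʳ {suc k} N ρ j = append-↑ʳ (N ∘ suc) ρ j

-- The innermost quantifier binds variable zero, in agreement with `append`, which puts the
-- quantified values before the parameters.
∃* : ∀ k {m} → Formula (k + m) → Formula m
∃* zero    φ = φ
∃* (suc k) φ = ∃* k (∃′ φ)

∃*-elim : ∀ k {m} (φ : Formula (k + m)) {ρ} → ⟦ ∃* k φ ⟧ ρ → Σ (Fin k → ℕ) λ N → ⟦ φ ⟧ (append N ρ)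
∃*-elim zero    φ p = (λ ()) , p
∃*-elim (suc k) φ p with ∃*-elim k (∃′ φ) p
... | N , x , q = extend x N , q

∃*-intro : ∀ k {m} (φ : Formula (k + m)) {ρ} (N : Fin k → ℕ) → ⟦ φ ⟧ (append N ρ) → ⟦ ∃* k φ ⟧ ρ
∃*-intro zero    φ N p = p
∃*-intro (suc k) φ N p = ∃*-intro k (∃′ φ) (N ∘ suc) (N zero , p)

-- Reduction to the balanced case by removing vertices

satF : ∀ {n} → Bool → ℕ → Term n → Formula n
satF true  d t = numeral d ≤′ t
satF false d t = t ≡′ numeral d

satF-elim : ∀ {n} b d (t : Term n) {ρ} → ⟦ satF b d t ⟧ ρ → Sat b d (⟦ t ⟧t ρ)
satF-elim true  d t {ρ} p = subst (_≤ ⟦ t ⟧t ρ) (numeral-sem d ρ) p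
satF-elim false d t {ρ} p = trans p (numeral-sem d ρ)

satF-intro : ∀ {n} b d (t : Term n) {ρ} → Sat b d (⟦ t ⟧t ρ) → ⟦ satF b d t ⟧ ρ
satF-intro true  d t {ρ} p = subst (_≤ ⟦ t ⟧t ρ) (sym (numeral-sem d ρ)) p
satF-intro false d t {ρ} p = trans p (sym (numeral-sem d ρ))

Sat-∸ : ∀ b {d e x} → Sat b d (e + x) → Sat b (d ∸ e) x
Sat-∸ true  {d} {e} {x} p = ≤-trans (∸-monoˡ-≤ e p) (≤-reflexive (m+n∸m≡n e x))
Sat-∸ false {d} {e} {x} p = trans (sym (m+n∸m≡n e x)) (cong (_∸ e) p)

-- Truncated subtraction does no harm to a lower bound, but an exact demand smaller than `e` would
-- be lowered to zero and wrongly count as met.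
Sat-+ : ∀ b {d e x} → (b ≡ true ⊎ e ≤ d) → Sat b (d ∸ e) x → Sat b d (e + x)
Sat-+ true  {d} {e} {x} _ p = ≤-trans (m≤n+m∸n d e) (+-monoʳ-≤ e p)
Sat-+ false {d} {e} {x} (inj₂ e≤d) p = trans (cong (e +_) p) (m+[n∸m]≡n e≤d)

⊓-strict : ∀ {a b c} → a < b → b < c → a ⊓ c < b ⊓ c
⊓-strict {a} {b} {c} a<b b<c = ≤-<-trans (m⊓n≤m a c) (<-≤-trans a<b (≤-reflexive (sym (m≤n⇒m⊓n≡m (<⇒≤ b<c)))))

module Elimination {τ ℓ κ : ℕ} (inv : Fin τ → Fin τ) (inv-inv : ∀ t → inv (inv t) ≡ t) (inv≢ : ∀ t → inv t ≢ t)
  (colour : Fin τ → Fin ℓ) (colour-fibre : ∀ s t → colour s ≡ colour t → s ≡ t ⊎ s ≡ inv t)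
  (colour-inv : ∀ t → colour (inv t) ≡ colour t)
  (out : Fin ℓ → Fin τ) (colour-out : ∀ i → colour (out i) ≡ i) (K : ℕ)
  (big : Fin κ → Fin τ → Bool)
  where

  open Graphs inv inv-inv
  open Planting inv inv-inv inv≢ colour colour-fibre colour-inv out colour-out K using (L)
  open Realisation inv inv-inv inv≢ colour colour-fibre colour-inv out colour-out K big

  -- The vertices of class j behave like those of the original class orig j, except that their demands have been lowered to b j.
  record Instance (m : ℕ) : Set where
    field
      orig : Fin m → Fin κ
      b    : Fin m → Fin τ → ℕ
      b≤K  : ∀ j t → b j t ≤ K

    bigAt : Fin m → Fin τ → Bool
    bigAt j = big (orig j)

  open Instance

  Exists : ∀ {m} → Instance m → (Fin m → ℕ) → Set
  Exists {m} I N = Σ ℕ λ n → Σ (Fin n → Fin m) λ part → (∀ j → ∑ (λ v → δ (part v) j) ≡ N j) ×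
    Σ (PGraph n) (Realised (orig I ∘ part) (b I ∘ part))

  -- After the removal of a vertex v, the class (j , t) consists of those vertices of class j which see v under the label t.
  cls : ∀ {m} → Fin (m * τ) → Fin m
  cls k = proj₁ (remQuot τ k)

  lb : ∀ {m} → Fin (m * τ) → Fin τ
  lb {m} k = proj₂ (remQuot {m} τ k)

  split : ∀ {m} → Instance m → Instance (m * τ)
  split {m} I = record
    { orig = λ k → orig I (cls k)
    ; b    = λ k s → b I (cls k) s ∸ δ (lb {m} k) s
    ; b≤K  = λ k s → ≤-trans (m∸n≤m _ (δ (lb {m} k) s)) (b≤K I (cls k) s)
    }

  -- A vertex whose exact demand for a label is zero cannot see the removed vertex under it, so the
  -- other classes must be empty. This is the side condition that reversing the subtraction in
  -- `split` requires.
  Valid : ∀ {m} → Instance m → Fin (m * τ) → Set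
  Valid {m} I k = bigAt I (cls k) (lb {m} k) ≡ true ⊎ 1 ≤ b I (cls k) (lb {m} k)

  valid? : ∀ {m} (I : Instance m) k → Dec (Valid I k)
  valid? {m} I k = (bigAt I (cls k) (lb {m} k) Bool.≟ true) ⊎-dec (1 ≤? b I (cls k) (lb {m} k))

  linked? : ∀ o o′ → Dec (Linked o o′)
  linked? o o′ = any? (λ t → (big o t Bool.≟ true) ×-dec (big o′ (inv t) Bool.≟ true))

  -- The decision is taken while the formula is built, as it depends on the instance and not on the
  -- class sizes.
  unless : ∀ {P : Set} {n} → Dec P → Formula n → Formula n
  unless (yes _) φ = tt
  unless (no _)  φ = φ

  unless-elim : ∀ {P : Set} {n} (d : Dec P) (φ : Formula n) {ρ} → ⟦ unless d φ ⟧ ρ → P ⊎ ⟦ φ ⟧ ρ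
  unless-elim (yes p) φ _ = inj₁ p
  unless-elim (no _)  φ q = inj₂ q

  unless-intro : ∀ {P : Set} {n} (d : Dec P) (φ : Formula n) {ρ} → P ⊎ ⟦ φ ⟧ ρ → ⟦ unless d φ ⟧ ρ
  unless-intro (yes _) φ _        = _
  unless-intro (no ¬p) φ (inj₁ p) = contradiction p ¬p
  unless-intro (no _)  φ (inj₂ q) = q

  module Base {m : ℕ} (I : Instance m) where

    sizeT : Fin κ → Term m
    sizeT o = linear (λ j → δ (orig I j) o) (λ j → j)

    totalT absorbersT : Fin τ → Term m
    totalT t     = linear (λ j → b I j t) (λ j → j)
    absorbersT t = linear (λ j → 𝟏 (bigAt I j t)) (λ j → j)

    zero-or-large : ℕ → Term m → Formula m
    zero-or-large c t = (t ≡′ 𝟘) ∨′ (numeral c ≤′ t)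

    zero-or-large-sem : ∀ c t {ρ x} → ⟦ t ⟧t ρ ≡ x →
      (⟦ zero-or-large c t ⟧ ρ → x ≡ 0 ⊎ c ≤ x) × (x ≡ 0 ⊎ c ≤ x → ⟦ zero-or-large c t ⟧ ρ)
    zero-or-large-sem c t {ρ} refl =
      Sum.map (λ e → e) (subst (_≤ ⟦ t ⟧t ρ) (numeral-sem c ρ)) ,
      Sum.map (λ e → e) (subst (_≤ ⟦ t ⟧t ρ) (sym (numeral-sem c ρ)))

    sizesF totalsF absorptionF linkageF baseF : Formula m
    sizesF      = ⋀ (λ o → zero-or-large M (sizeT o))
    totalsF     = ⋀ (λ t → zero-or-large L (totalT t))
    absorptionF = ⋀ (λ t → (𝟙 ≤′ absorbersT t) ∨′ (totalT (inv t) ≤′ totalT t))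
    linkageF    = ⋀ (λ o → ⋀ (λ o′ → unless (linked? o o′) ((sizeT o ≡′ 𝟘) ∨′ (sizeT o′ ≡′ 𝟘))))
    baseF       = (sizesF ∧′ totalsF) ∧′ (absorptionF ∧′ linkageF)

    module _ {n : ℕ} (part : Fin n → Fin m) {N : Fin m → ℕ} (counts : ∀ j → ∑ (λ v → δ (part v) j) ≡ N j) where

      ob = orig I ∘ part
      dem = b I ∘ part

      linear-fibres : (f : Fin m → ℕ) → ⟦ linear f (λ j → j) ⟧t N ≡ ∑ (λ v → f (part v))
      linear-fibres f = trans (linear-sem f (λ j → j) N)
        (trans (∑-cong λ j → cong (f j *_) (sym (counts j))) (sym (∑-fibres part f)))

      size-sem : ∀ o → ⟦ sizeT o ⟧t N ≡ size ob dem o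
      size-sem o = linear-fibres _

      total-sem : ∀ t → ⟦ totalT t ⟧t N ≡ total ob dem t
      total-sem t = linear-fibres _

      absorbers-sem : ∀ t → ⟦ absorbersT t ⟧t N ≡ absorbers ob dem t
      absorbers-sem t = linear-fibres _

      baseF-elim : ⟦ baseF ⟧ N → Balanced (size ob dem) (total ob dem) × Consistent (size ob dem) (total ob dem) (absorbers ob dem)
      baseF-elim ((p , q) , (r , s)) =
        balanced (λ o → proj₁ (zero-or-large-sem M (sizeT o) (size-sem o)) (⋀-elim _ p o))
                 (λ t → proj₁ (zero-or-large-sem L (totalT t) (total-sem t)) (⋀-elim _ q t)) ,
        consistent (λ t → Sum.map (subst (0 <_) (absorbers-sem t)) (subst₂ _≤_ (total-sem (inv t)) (total-sem t)) (⋀-elim _ r t))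
                   (λ o o′ → Sum.map₂ (Sum.map (trans (sym (size-sem o))) (trans (sym (size-sem o′))))
                     (unless-elim (linked? o o′) ((sizeT o ≡′ 𝟘) ∨′ (sizeT o′ ≡′ 𝟘)) (⋀-elim _ (⋀-elim _ s o) o′)))

      baseF-intro : Balanced (size ob dem) (total ob dem) → Consistent (size ob dem) (total ob dem) (absorbers ob dem) → ⟦ baseF ⟧ N
      baseF-intro (balanced sizes totals) (consistent absorption linkage) =
        (⋀-intro _ (λ o → proj₂ (zero-or-large-sem M (sizeT o) (size-sem o)) (sizes o)) ,
         ⋀-intro _ (λ t → proj₂ (zero-or-large-sem L (totalT t) (total-sem t)) (totals t))) ,
        (⋀-intro _ (λ t → Sum.map (subst (0 <_) (sym (absorbers-sem t)))
                            (subst₂ _≤_ (sym (total-sem (inv t))) (sym (total-sem t))) (absorption t)) ,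
         ⋀-intro _ (λ o → ⋀-intro _ (λ o′ → unless-intro (linked? o o′) ((sizeT o ≡′ 𝟘) ∨′ (sizeT o′ ≡′ 𝟘))
                            (Sum.map₂ (Sum.map (trans (size-sem o)) (trans (size-sem o′))) (linkage o o′)))))

  open Base using (baseF; baseF-elim; baseF-intro)

  module Removal {m : ℕ} (I : Instance m) (j₀ : Fin m) where

    countsF : Fin m → Formula (m * τ + m)
    countsF j = var (m * τ ↑ʳ j) ≡′ (numeral (δ j₀ j) ⊕ linear (λ k → δ (cls k) j) (_↑ˡ m))

    validF : Fin (m * τ) → Formula (m * τ + m)
    validF k = unless (valid? I k) (var (k ↑ˡ m) ≡′ 𝟘)

    -- Classes record how a vertex sees the removed one; that vertex sees the same edge under the
    -- inverse label, hence `inv t`.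
    degreeT : Fin τ → Term (m * τ + m)
    degreeT t = linear (λ k → δ (lb {m} k) (inv t)) (_↑ˡ m)

    degreeF : Fin τ → Formula (m * τ + m)
    degreeF t = satF (bigAt I j₀ t) (b I j₀ t) (degreeT t)

    removeF : Formula (m * τ) → Formula m
    removeF φ = ∃* (m * τ) (((⋀ countsF ∧′ ⋀ validF) ∧′ ⋀ degreeF) ∧′ rename (_↑ˡ m) φ)

    record Removed (N : Fin m → ℕ) (N′ : Fin (m * τ) → ℕ) : Set where
      field
        counts  : ∀ j → N j ≡ δ j₀ j + ∑ (λ k → δ (cls k) j * N′ k)
        valid   : ∀ k → Valid I k ⊎ N′ k ≡ 0
        degrees : ∀ t → Sat (bigAt I j₀ t) (b I j₀ t) (∑ (λ k → δ (lb {m} k) (inv t) * N′ k))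

    module _ (N : Fin m → ℕ) (N′ : Fin (m * τ) → ℕ) where

      linear-append : ∀ f → ⟦ linear f (_↑ˡ m) ⟧t (append N′ N) ≡ ∑ (λ k → f k * N′ k)
      linear-append f = trans (linear-sem f (_↑ˡ m) (append N′ N)) (∑-cong λ k → cong (f k *_) (append-↑ˡ N′ N k))

      counts-sem : ∀ j → ⟦ numeral (δ j₀ j) ⊕ linear (λ k → δ (cls k) j) (_↑ˡ m) ⟧t (append N′ N) ≡
        δ j₀ j + ∑ (λ k → δ (cls k) j * N′ k)
      counts-sem j = cong₂ _+_ (numeral-sem (δ j₀ j) (append N′ N)) (linear-append _)

    removeF-elim : ∀ φ {N} → ⟦ removeF φ ⟧ N → Σ (Fin (m * τ) → ℕ) λ N′ → Removed N N′ × ⟦ φ ⟧ N′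
    removeF-elim φ {N} p with ∃*-elim (m * τ) _ p
    ... | N′ , ((c , v) , d) , r = N′ , record
      { counts  = λ j → trans (sym (append-↑ʳ N′ N j)) (trans (⋀-elim countsF c j) (counts-sem N N′ j))
      ; valid   = λ k → Sum.map₂ (trans (sym (append-↑ˡ N′ N k))) (unless-elim (valid? I k) (var (k ↑ˡ m) ≡′ 𝟘) (⋀-elim validF v k))
      ; degrees = λ t → subst (Sat _ _) (linear-append N N′ _) (satF-elim (bigAt I j₀ t) (b I j₀ t) (degreeT t) (⋀-elim degreeF d t))
      } , proj₁ (rename-sem (_↑ˡ m) (append-↑ˡ N′ N) φ) r

    removeF-intro : ∀ φ {N} N′ → Removed N N′ → ⟦ φ ⟧ N′ → ⟦ removeF φ ⟧ N
    removeF-intro φ {N} N′ R p = ∃*-intro (m * τ) _ N′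
      (((⋀-intro countsF (λ j → trans (append-↑ʳ N′ N j) (trans (counts j) (sym (counts-sem N N′ j)))) ,
         ⋀-intro validF (λ k → unless-intro (valid? I k) (var (k ↑ˡ m) ≡′ 𝟘) (Sum.map₂ (trans (append-↑ˡ N′ N k)) (valid k)))) ,
        ⋀-intro degreeF (λ t → satF-intro (bigAt I j₀ t) (b I j₀ t) (degreeT t) (subst (Sat _ _) (sym (linear-append N N′ _)) (degrees t)))) ,
       proj₂ (rename-sem (_↑ˡ m) (append-↑ˡ N′ N) φ) p)
      where open Removed R

    open Removed

    -- No choice arises: the class of each vertex already names the label of its edge to the new
    -- vertex.
    insert-vertex : ∀ {N N′} → Removed N N′ → Exists (split I) N′ → Exists I N
    insert-vertex {N} {N′} R (n , part′ , counts′ , H′ , H′-total , H′-sat) = suc n , part , part-counts , H , H-complete , sat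
      where
      part : Fin (suc n) → Fin m
      part zero    = j₀
      part (suc u) = cls (part′ u)

      fibres : (f : Fin (m * τ) → ℕ) → ∑ (λ u → f (part′ u)) ≡ ∑ (λ k → f k * N′ k)
      fibres f = trans (∑-fibres part′ f) (∑-cong λ k → cong (f k *_) (counts′ k))

      part-counts : ∀ j → ∑ (λ v → δ (part v) j) ≡ N j
      part-counts j = trans (∑-suc _) (trans (cong (δ j₀ j +_) (fibres (λ k → δ (cls k) j))) (sym (counts R j)))

      towards : Fin n → Fin τ
      towards u = lb {m} (part′ u)

      H-lab : Fin (suc n) → Fin (suc n) → Maybe (Fin τ)
      H-lab zero    zero    = nothing
      H-lab zero    (suc u) = just (inv (towards u))
      H-lab (suc u) zero    = just (towards u)
      H-lab (suc u) (suc w) = lab H′ u w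

      H : PGraph (suc n)
      H = record { lab = H-lab ; loopless = H-loopless ; lab-inv = H-lab-inv }
        where
        H-loopless : ∀ v → H-lab v v ≡ nothing
        H-loopless zero    = refl
        H-loopless (suc v) = loopless H′ v

        H-lab-inv : ∀ u w → H-lab w u ≡ Maybe.map inv (H-lab u w)
        H-lab-inv zero    zero    = refl
        H-lab-inv zero    (suc w) = cong just (sym (inv-inv (towards w)))
        H-lab-inv (suc u) zero    = refl
        H-lab-inv (suc u) (suc w) = lab-inv H′ u w

      H-complete : ∀ u w → u ≢ w → Σ (Fin τ) λ t → H-lab u w ≡ just t
      H-complete zero    zero    ≢ = contradiction refl ≢
      H-complete zero    (suc w) _ = _ , refl
      H-complete (suc u) zero    _ = _ , refl
      H-complete (suc u) (suc w) ≢ = H′-total u w (≢ ∘ cong suc)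

      valid-part : ∀ u → Valid I (part′ u)
      valid-part u with valid R (part′ u)
      ... | inj₁ v = v
      ... | inj₂ e = contradiction (≤-trans (≤-reflexive (sym (δ-refl (part′ u))))
                       (≤-trans (term≤∑ (λ v → δ (part′ v) (part′ u)) u) (≤-reflexive (trans (counts′ (part′ u)) e)))) λ ()

      demand-fits : ∀ u t → bigAt I (cls (part′ u)) t ≡ true ⊎ δ (towards u) t ≤ b I (cls (part′ u)) t
      demand-fits u t with towards u ≟ t | valid-part u
      ... | yes refl | v = Sum.map₂ (≤-trans (δ≤1 t t)) v
      ... | no ≢t    | _ = inj₂ (≤-trans (≤-reflexive (δ-≢ ≢t)) z≤n)

      inv-δ : ∀ s t → δ (inv s) t ≡ δ s (inv t)
      inv-δ s t = trans (cong (δ (inv s)) (sym (inv-inv t))) (δ-injective inv inv-injective s (inv t))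

      sat : ∀ t v → Sat (bigAt I (part v) t) (b I (part v) t) (deg H t v)
      sat t zero    = subst (Sat _ _) (sym (trans (∑-suc _) (trans (∑-cong λ u → inv-δ (towards u) t) (fibres (λ k → δ (lb {m} k) (inv t))))))
                        (degrees R t)
      sat t (suc u) = subst (Sat _ _) (sym (∑-suc _)) (Sat-+ (bigAt I (cls (part′ u)) t) (demand-fits u t) (H′-sat t u))

    module Delete {n : ℕ} (part : Fin (suc n) → Fin m) {N : Fin m → ℕ} (counts₀ : ∀ j → ∑ (λ v → δ (part v) j) ≡ N j)
      (H : PGraph (suc n)) (H-realised : Realised (orig I ∘ part) (b I ∘ part) H)
      (v : Fin (suc n)) (v∈j₀ : part v ≡ j₀)
      where

      towards : Fin n → Fin τ
      towards u = proj₁ (proj₁ H-realised (punchIn v u) v (FinP.punchInᵢ≢i v u))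

      lab-towards : ∀ u → lab H (punchIn v u) v ≡ just (towards u)
      lab-towards u = proj₂ (proj₁ H-realised (punchIn v u) v (FinP.punchInᵢ≢i v u))

      part′ : Fin n → Fin (m * τ)
      part′ u = combine (part (punchIn v u)) (towards u)

      N′ : Fin (m * τ) → ℕ
      N′ k = ∑ (λ u → δ (part′ u) k)

      cls-part′ : ∀ u → cls (part′ u) ≡ part (punchIn v u)
      cls-part′ u = cong proj₁ (FinP.remQuot-combine (part (punchIn v u)) (towards u))

      lb-part′ : ∀ u → lb {m} (part′ u) ≡ towards u
      lb-part′ u = cong proj₂ (FinP.remQuot-combine (part (punchIn v u)) (towards u))

      H′ : PGraph n
      H′ = record
        { lab      = λ u w → lab H (punchIn v u) (punchIn v w)
        ; loopless = λ u → loopless H (punchIn v u)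
        ; lab-inv  = λ u w → lab-inv H (punchIn v u) (punchIn v w)
        }

      deg-punchIn : ∀ t u → deg H t (punchIn v u) ≡ δ (towards u) t + deg H′ t u
      deg-punchIn t u = trans (∑-remove _ v) (cong (λ x → has t x + deg H′ t u) (lab-towards u))

      sat-at : ∀ t u → Sat (bigAt I (part (punchIn v u)) t) (b I (part (punchIn v u)) t) (δ (towards u) t + deg H′ t u)
      sat-at t u = subst (Sat _ _) (deg-punchIn t u) (proj₂ H-realised t (punchIn v u))

      H′-realised : Realised (orig (split I) ∘ part′) (b (split I) ∘ part′) H′
      H′-realised = (λ u w u≢w → proj₁ H-realised (punchIn v u) (punchIn v w) (u≢w ∘ FinP.punchIn-injective v u w)) ,
        λ t u → subst₂ (λ j s → Sat (bigAt I j t) (b I j t ∸ δ s t) (deg H′ t u)) (sym (cls-part′ u)) (sym (lb-part′ u))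
          (Sat-∸ (bigAt I (part (punchIn v u)) t) (sat-at t u))

      fibres : (f : Fin (m * τ) → ℕ) → ∑ (λ k → f k * N′ k) ≡ ∑ (λ u → f (part′ u))
      fibres f = sym (∑-fibres part′ f)

      valid-part′ : ∀ u → Valid I (part′ u)
      valid-part′ u = subst₂ (λ j s → bigAt I j s ≡ true ⊎ 1 ≤ b I j s) (sym (cls-part′ u)) (sym (lb-part′ u))
        (positive (bigAt I (part (punchIn v u)) (towards u)) (sat-at (towards u) u))
        where
        positive : ∀ β {d x} → Sat β d (δ (towards u) (towards u) + x) → β ≡ true ⊎ 1 ≤ d
        positive true  _    = inj₁ refl
        positive false refl = inj₂ (≤-trans (≤-reflexive (sym (δ-refl (towards u)))) (m≤m+n _ _))

      removed : Removed N N′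
      removed = record
        { counts  = λ j → trans (sym (counts₀ j)) (trans (∑-remove _ v) (cong₂ _+_ (cong (λ i → δ i j) v∈j₀)
            (trans (∑-cong λ u → cong (λ i → δ i j) (sym (cls-part′ u))) (sym (fibres (λ k → δ (cls k) j))))))
        ; valid   = valid′
        ; degrees = λ t → subst₂ (λ j x → Sat (bigAt I j t) (b I j t) x) v∈j₀ (degree-v t) (proj₂ H-realised t v)
        }
        where
        valid′ : ∀ k → Valid I k ⊎ N′ k ≡ 0
        valid′ k with 0 <? N′ k
        ... | no ¬p = inj₂ (n≤0⇒n≡0 (≮⇒≥ ¬p))
        ... | yes p with ∑-positive _ p
        ...   | u , q = inj₁ (subst (Valid I) (δ⇒≡ q) (valid-part′ u))

        seen-from-v : ∀ t u → has t (lab H v (punchIn v u)) ≡ δ (lb {m} (part′ u)) (inv t)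
        seen-from-v t u = begin
          has t (lab H v (punchIn v u))                  ≡⟨ has-inv t (lab H v (punchIn v u)) ⟨
          has (inv t) (Maybe.map inv (lab H v (punchIn v u)))  ≡⟨ cong (has (inv t)) (lab-inv H v (punchIn v u)) ⟨
          has (inv t) (lab H (punchIn v u) v)            ≡⟨ cong (has (inv t)) (lab-towards u) ⟩
          δ (towards u) (inv t)                          ≡⟨ cong (λ s → δ s (inv t)) (lb-part′ u) ⟨
          δ (lb {m} (part′ u)) (inv t)                   ∎
          where open ≡-Reasoning

        degree-v : ∀ t → deg H t v ≡ ∑ (λ k → δ (lb {m} k) (inv t) * N′ k)
        degree-v t = trans (∑-remove _ v) (trans (cong₂ _+_ (cong (has t) (loopless H v)) (∑-cong (seen-from-v t)))
                       (sym (fibres (λ k → δ (lb {m} k) (inv t)))))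

      size-drop : ∀ o → size (orig I ∘ part) (b I ∘ part) o ≡
        δ (orig I (part v)) o + size (orig (split I) ∘ part′) (b (split I) ∘ part′) o
      size-drop o = trans (∑-remove _ v) (cong (δ (orig I (part v)) o +_)
        (∑-cong λ u → cong (λ j → δ (orig I j) o) (sym (cls-part′ u))))

      -- An inequality, because besides the demand of `v` those of the remaining vertices may drop
      -- too.
      total-drop : ∀ t → b I (part v) t + total (orig (split I) ∘ part′) (b (split I) ∘ part′) t ≤
        total (orig I ∘ part) (b I ∘ part) t
      total-drop t = ≤-trans
        (+-monoʳ-≤ (b I (part v) t) (∑-mono λ u → ≤-trans (m∸n≤m _ (δ (lb {m} (part′ u)) t)) (≤-reflexive (cong (λ j → b I j t) (cls-part′ u)))))
        (≤-reflexive (sym (∑-remove _ v)))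

  open Removal using (removeF; removeF-elim; removeF-intro; insert-vertex)

  -- `r` bounds the number of deletions. `baseF` is offered at every level because a balanced
  -- remainder may be reached early.
  formula : ∀ (r : ℕ) {m} → Instance m → Formula m
  formula zero    I = baseF I
  formula (suc r) I = baseF I ∨′ ⋁ (λ j₀ → removeF I j₀ (formula r (split I)))

  base-sound : ∀ {m} (I : Instance m) N → ⟦ baseF I ⟧ N → Exists I N
  base-sound I N p with listing N
  ... | n , part , counts with baseF-elim I part counts p
  ...   | bal , con = n , part , counts , realise (orig I ∘ part) (b I ∘ part) (λ u → b≤K I (part u)) bal con

  sound : ∀ r {m} (I : Instance m) N → ⟦ formula r I ⟧ N → Exists I N
  sound zero    I N p        = base-sound I N p
  sound (suc r) I N (inj₁ p) = base-sound I N p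
  sound (suc r) I N (inj₂ p) with ⋁-elim _ p
  ... | j₀ , q with removeF-elim I j₀ (formula r (split I)) q
  ...   | N′ , R , q′ = insert-vertex I j₀ R (sound r (split I) N′ q′)

  potential : ∀ {n} → (Fin n → Fin κ) → (Fin n → Fin τ → ℕ) → ℕ
  potential ob dem = ∑ (λ o → size ob dem o ⊓ M) + ∑ (λ t → total ob dem t ⊓ L)

  base-formula : ∀ r {m} (I : Instance m) {N} → ⟦ baseF I ⟧ N → ⟦ formula r I ⟧ N
  base-formula zero    I p = p
  base-formula (suc r) I p = inj₁ p

  all-zero-or-large : ∀ {k} (f : Fin k → ℕ) c → (∀ i → f i ≡ 0 ⊎ c ≤ f i) ⊎ (Σ (Fin k) λ i → 0 < f i × f i < c)
  all-zero-or-large f c with any? (λ i → (0 <? f i) ×-dec (f i <? c))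
  ... | yes p = inj₂ p
  ... | no ¬p = inj₁ dichotomy
    where
    dichotomy : ∀ i → f i ≡ 0 ⊎ c ≤ f i
    dichotomy i with 0 <? f i | f i <? c
    ... | no z  | _      = inj₁ (n≤0⇒n≡0 (≮⇒≥ z))
    ... | yes _ | no ≮c  = inj₂ (≮⇒≥ ≮c)
    ... | yes z | yes <c = contradiction (i , z , <c) ¬p

  Critical : ∀ {n} → (Fin n → Fin κ) → (Fin n → Fin τ → ℕ) → Fin n → Set
  Critical ob dem v = (size ob dem (ob v) < M) ⊎ (Σ (Fin τ) λ t → 0 < dem v t × total ob dem t < L)

  balanced-or-critical : ∀ {n} (ob : Fin n → Fin κ) dem → Balanced (size ob dem) (total ob dem) ⊎ Σ (Fin n) (Critical ob dem)
  balanced-or-critical ob dem with all-zero-or-large (size ob dem) M | all-zero-or-large (total ob dem) L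
  ... | inj₁ p | inj₁ q = inj₁ (balanced p q)
  ... | inj₂ (o , pos , small) | _ with ∑-positive _ pos
  ...   | v , p = inj₂ (v , inj₁ (subst (λ o → size ob dem o < M) (sym (δ⇒≡ p)) small))
  balanced-or-critical ob dem | inj₁ _ | inj₂ (t , pos , small) with ∑-positive _ pos
  ...   | v , p = inj₂ (v , inj₂ (t , p , small))

  complete-formula : ∀ r {m n} (I : Instance m) (part : Fin n → Fin m) {N} → (∀ j → ∑ (λ v → δ (part v) j) ≡ N j) →
    (H : PGraph n) → Realised (orig I ∘ part) (b I ∘ part) H → potential (orig I ∘ part) (b I ∘ part) ≤ r → ⟦ formula r I ⟧ N
  complete-formula r {m} {n} I part {N} counts H realised pot with balanced-or-critical (orig I ∘ part) (b I ∘ part)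
  ... | inj₁ bal@(balanced sizes _) = base-formula r I (baseF-intro I part counts bal
          (necessary (orig I ∘ part) (b I ∘ part) (λ u → b≤K I (part u)) H (proj₁ realised) (proj₂ realised) sizes))
  complete-formula r {m} {suc n} I part {N} counts H realised pot | inj₂ (v , critical) = by-fuel r pot
    where
    open Removal.Delete I (part v) part counts H realised v refl

    ob  = orig I ∘ part
    dem = b I ∘ part
    ob′  = orig (split I) ∘ part′
    dem′ = b (split I) ∘ part′

    size≤ : ∀ o → size ob′ dem′ o ≤ size ob dem o
    size≤ o = ≤-trans (m≤n+m _ _) (≤-reflexive (sym (size-drop o)))

    total≤ : ∀ t → total ob′ dem′ t ≤ total ob dem t
    total≤ t = ≤-trans (m≤n+m _ (dem v t)) (total-drop t)

    sizes⊓ : ∀ o → size ob′ dem′ o ⊓ M ≤ size ob dem o ⊓ M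
    sizes⊓ o = ⊓-monoˡ-≤ M (size≤ o)

    totals⊓ : ∀ t → total ob′ dem′ t ⊓ L ≤ total ob dem t ⊓ L
    totals⊓ t = ⊓-monoˡ-≤ L (total≤ t)

    -- No summand grows under deletion, and a critical vertex lowers one that lies below its
    -- threshold, where truncation cannot hide the loss.
    potential-drops : Critical ob dem v → potential ob′ dem′ < potential ob dem
    potential-drops (inj₁ small) = +-mono-<-≤ (∑-mono-< sizes⊓ (ob v) (⊓-strict size< small)) (∑-mono totals⊓)
      where
      size< : size ob′ dem′ (ob v) < size ob dem (ob v)
      size< = ≤-reflexive (sym (trans (size-drop (ob v)) (cong (_+ size ob′ dem′ (ob v)) (δ-refl (ob v)))))
    potential-drops (inj₂ (t , pos , small)) = +-mono-≤-< (∑-mono sizes⊓) (∑-mono-< totals⊓ t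
      (⊓-strict (≤-trans (+-monoˡ-≤ (total ob′ dem′ t) pos) (total-drop t)) small))

    by-fuel : ∀ r → potential ob dem ≤ r → ⟦ formula r I ⟧ N
    by-fuel zero    p = contradiction (<-≤-trans (potential-drops critical) p) λ ()
    by-fuel (suc r) p = inj₂ (⋁-intro _ (part v) (removeF-intro I (part v) (formula r (split I)) N′ removed
      (complete-formula r (split I) part′ (λ _ → refl) H′ H′-realised (≤-pred (<-≤-trans (potential-drops critical) p)))))

  definable : ∀ {m} (I : Instance m) → Σ (Formula m) λ φ → ∀ N → (Exists I N → ⟦ φ ⟧ N) × (⟦ φ ⟧ N → Exists I N)
  definable I = formula fuel I , λ N →
    (λ (n , part , counts , H , realised) → complete-formula fuel I part counts H realised
      (+-mono-≤ (≤-trans (∑-mono λ o → m⊓n≤n _ M) (≤-reflexive (∑-const κ M)))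
                (≤-trans (∑-mono λ t → m⊓n≤n _ L) (≤-reflexive (∑-const τ L))))) ,
    sound fuel I N
    where fuel = κ * M + τ * L

-- Digraphs as labelled graphs

isBig : 𝔹 → Bool
isBig (exactly _) = false
isBig (atLeast _) = true

value : 𝔹 → ℕ
value (exactly d) = d
value (atLeast d) = d

Sat⇒≐ : ∀ β {x} → Sat (isBig β) (value β) x → x ≐ β
Sat⇒≐ (exactly d) p = p
Sat⇒≐ (atLeast d) p = p

≐⇒Sat : ∀ β {x} → x ≐ β → Sat (isBig β) (value β) x
≐⇒Sat (exactly d) p = p
≐⇒Sat (atLeast d) p = p

module Digraphs (ℓ m : ℕ) (C D : Fin ℓ → Fin m → 𝔹) where

  -- The tail of an edge of colour `i` sees it under `out i`, the head under `inn i`.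
  out inn : Fin ℓ → Fin (ℓ + ℓ)
  out i = i ↑ˡ ℓ
  inn i = ℓ ↑ʳ i

  data LabelView : Fin (ℓ + ℓ) → Set where
    is-out : ∀ i → LabelView (out i)
    is-inn : ∀ i → LabelView (inn i)

  labelView : ∀ t → LabelView t
  labelView t with splitAt ℓ t in e
  ... | inj₁ i = subst LabelView (FinP.splitAt⁻¹-↑ˡ e) (is-out i)
  ... | inj₂ i = subst LabelView (FinP.splitAt⁻¹-↑ʳ e) (is-inn i)

  cases : ∀ {A : Set} → (Fin ℓ → A) → (Fin ℓ → A) → Fin (ℓ + ℓ) → A
  cases f g t = [ f , g ]′ (splitAt ℓ t)

  cases-out : ∀ {A : Set} (f g : Fin ℓ → A) i → cases f g (out i) ≡ f i
  cases-out f g i = cong [ f , g ]′ (FinP.splitAt-↑ˡ ℓ i ℓ)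

  cases-inn : ∀ {A : Set} (f g : Fin ℓ → A) i → cases f g (inn i) ≡ g i
  cases-inn f g i = cong [ f , g ]′ (FinP.splitAt-↑ʳ ℓ ℓ i)

  out≢inn : ∀ i j → out i ≢ inn j
  out≢inn i j e = contradiction
    (trans (sym (FinP.splitAt-↑ˡ ℓ i ℓ)) (trans (cong (splitAt ℓ) e) (FinP.splitAt-↑ʳ ℓ ℓ j))) λ ()

  inv : Fin (ℓ + ℓ) → Fin (ℓ + ℓ)
  inv = cases inn out

  inv-out : ∀ i → inv (out i) ≡ inn i
  inv-out = cases-out inn out

  inv-inn : ∀ i → inv (inn i) ≡ out i
  inv-inn = cases-inn inn out

  inv-inv : ∀ t → inv (inv t) ≡ t
  inv-inv t with labelView t
  ... | is-out i = trans (cong inv (inv-out i)) (inv-inn i)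
  ... | is-inn i = trans (cong inv (inv-inn i)) (inv-out i)

  inv≢ : ∀ t → inv t ≢ t
  inv≢ t e with labelView t
  ... | is-out i = out≢inn i i (trans (sym e) (inv-out i))
  ... | is-inn i = out≢inn i i (trans (sym (inv-inn i)) e)

  colour : Fin (ℓ + ℓ) → Fin ℓ
  colour = cases (λ i → i) (λ i → i)

  colour-out : ∀ i → colour (out i) ≡ i
  colour-out = cases-out (λ i → i) (λ i → i)

  colour-inn : ∀ i → colour (inn i) ≡ i
  colour-inn = cases-inn (λ i → i) (λ i → i)

  colour-inv : ∀ t → colour (inv t) ≡ colour t
  colour-inv t with labelView t
  ... | is-out i = trans (cong colour (inv-out i)) (trans (colour-inn i) (sym (colour-out i)))
  ... | is-inn i = trans (cong colour (inv-inn i)) (trans (colour-out i) (sym (colour-inn i)))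

  colour-fibre : ∀ s t → colour s ≡ colour t → s ≡ t ⊎ s ≡ inv t
  colour-fibre s t e with labelView s | labelView t
  ... | is-out i | is-out j = inj₁ (cong out (trans (sym (colour-out i)) (trans e (colour-out j))))
  ... | is-inn i | is-inn j = inj₁ (cong inn (trans (sym (colour-inn i)) (trans e (colour-inn j))))
  ... | is-out i | is-inn j = inj₂ (trans (cong out (trans (sym (colour-out i)) (trans e (colour-inn j)))) (sym (inv-inn j)))
  ... | is-inn i | is-out j = inj₂ (trans (cong inn (trans (sym (colour-inn i)) (trans e (colour-out j)))) (sym (inv-out j)))

  bound : Fin m → Fin (ℓ + ℓ) → 𝔹
  bound j = cases (λ i → D i j) (λ i → C i j)

  bound-out : ∀ j i → bound j (out i) ≡ D i j
  bound-out j = cases-out (λ i → D i j) (λ i → C i j)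

  bound-inn : ∀ j i → bound j (inn i) ≡ C i j
  bound-inn j = cases-inn (λ i → D i j) (λ i → C i j)

  -- The sum serves as a convenient common bound of all demands.
  K : ℕ
  K = ∑ (λ j → ∑ (λ t → value (bound j t)))

  big : Fin m → Fin (ℓ + ℓ) → Bool
  big j t = isBig (bound j t)

  open Graphs inv inv-inv
  open Elimination inv inv-inv inv≢ colour colour-fibre colour-inv out colour-out K big

  initial : Instance m
  initial = record
    { orig = λ j → j
    ; b    = λ j t → value (bound j t)
    ; b≤K  = λ j t → ≤-trans (term≤∑ (λ t → value (bound j t)) t) (term≤∑ (λ j → ∑ (λ t → value (bound j t))) j)
    }

  carries : Fin (ℓ + ℓ) → Maybe (Fin (ℓ + ℓ)) → Bool
  carries t nothing  = false
  carries t (just s) = s ==ᶠ t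

  has≡carries : ∀ t x → has t x ≡ 𝟏 (carries t x)
  has≡carries t nothing  = refl
  has≡carries t (just _) = refl

  carries⇒just : ∀ t x → carries t x ≡ true → x ≡ just t
  carries⇒just t (just s) e = cong just (==ᶠ-sound s t e)

  module ToDigraph {n : ℕ} (H : PGraph n) (H-total : ∀ u w → u ≢ w → Σ (Fin (ℓ + ℓ)) λ t → lab H u w ≡ just t) where

    reversed : ∀ u v i → lab H u v ≡ just (inn i) → lab H v u ≡ just (out i)
    reversed u v i e = trans (lab-inv H u v) (trans (cong (Maybe.map inv) e) (cong just (inv-inn i)))

    reversed′ : ∀ u v i → lab H u v ≡ just (out i) → lab H v u ≡ just (inn i)
    reversed′ u v i e = trans (lab-inv H u v) (trans (cong (Maybe.map inv) e) (cong just (inv-out i)))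

    digraph : Digraph ℓ n
    digraph = record
      { E           = λ i u v → carries (out i) (lab H u v)
      ; irreflexive = λ i v → cong (carries (out i)) (loopless H v)
      ; disjoint    = λ i j u v p q → FinP.↑ˡ-injective ℓ i j (just-injective
                        (trans (sym (carries⇒just (out i) (lab H u v) p)) (carries⇒just (out j) (lab H u v) q)))
      ; asymmetric  = asymmetric′
      }
      where
      asymmetric′ : ∀ i j u v → carries (out i) (lab H u v) ≡ true → carries (out j) (lab H v u) ≡ false
      asymmetric′ i j u v p rewrite reversed′ u v i (carries⇒just (out i) (lab H u v) p) with inn i ==ᶠ out j in e
      ... | false = refl
      ... | true  = contradiction (sym (==ᶠ-sound (inn i) (out j) e)) (out≢inn j i)

    digraph-complete : Complete digraph
    digraph-complete u v u≢v with H-total u v u≢v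
    ... | t , e with labelView t
    ...   | is-out i = i , inj₁ (trans (cong (carries (out i)) e) (==ᶠ-refl (out i)))
    ...   | is-inn i = i , inj₂ (trans (cong (carries (out i)) (reversed u v i e)) (==ᶠ-refl (out i)))

    out-deg≡deg : ∀ i v → out-deg digraph i v ≡ deg H (out i) v
    out-deg≡deg i v = trans (count≡∑ _) (∑-cong λ w → sym (has≡carries (out i) (lab H v w)))

    in-deg≡deg : ∀ i v → in-deg digraph i v ≡ deg H (inn i) v
    in-deg≡deg i v = trans (count≡∑ _) (∑-cong λ u → begin
      𝟏 (carries (out i) (lab H u v))                  ≡⟨ has≡carries (out i) (lab H u v) ⟨
      has (out i) (lab H u v)                          ≡⟨ has-inv (out i) (lab H u v) ⟨
      has (inv (out i)) (Maybe.map inv (lab H u v))    ≡⟨ cong₂ has (inv-out i) (sym (lab-inv H u v)) ⟩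
      has (inn i) (lab H v u)                          ∎)
      where open ≡-Reasoning

  module FromDigraph {n : ℕ} (G : Digraph ℓ n) (G-complete : Complete G) where

    R : Fin (ℓ + ℓ) → Fin n → Fin n → Bool
    R t u v = cases (λ i → E G i u v) (λ i → E G i v u) t

    R-out : ∀ i u v → R (out i) u v ≡ E G i u v
    R-out i u v = cases-out (λ i → E G i u v) (λ i → E G i v u) i

    R-inn : ∀ i u v → R (inn i) u v ≡ E G i v u
    R-inn i u v = cases-inn (λ i → E G i u v) (λ i → E G i v u) i

    R-inv : ∀ t u v → R (inv t) v u ≡ R t u v
    R-inv t u v with labelView t
    ... | is-out i = trans (cong (λ s → R s v u) (inv-out i)) (trans (R-inn i v u) (sym (R-out i u v)))
    ... | is-inn i = trans (cong (λ s → R s v u) (inv-inn i)) (trans (R-out i v u) (sym (R-inn i u v)))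

    R-irrefl : ∀ t v → R t v v ≡ false
    R-irrefl t v with labelView t
    ... | is-out i = trans (R-out i v v) (irreflexive G i v)
    ... | is-inn i = trans (R-inn i v v) (irreflexive G i v)

    -- Disjointness settles labels of the same direction, asymmetry those of opposite directions.
    -- The labels picked independently from the two ends of an edge are therefore inverse to each
    -- other.
    R-unique : ∀ s t u v → R s u v ≡ true → R t u v ≡ true → s ≡ t
    R-unique s t u v p q with labelView s | labelView t
    ... | is-out i | is-out j = cong out (disjoint G i j u v (trans (sym (R-out i u v)) p) (trans (sym (R-out j u v)) q))
    ... | is-inn i | is-inn j = cong inn (disjoint G i j v u (trans (sym (R-inn i u v)) p) (trans (sym (R-inn j u v)) q))
    ... | is-out i | is-inn j = contradiction
      (trans (sym (trans (sym (R-inn j u v)) q)) (asymmetric G i j u v (trans (sym (R-out i u v)) p))) λ ()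
    ... | is-inn i | is-out j = contradiction
      (trans (sym (trans (sym (R-inn i u v)) p)) (asymmetric G j i u v (trans (sym (R-out j u v)) q))) λ ()

    pick : ∀ u v → u ≢ v → Σ (Fin (ℓ + ℓ)) λ t → R t u v ≡ true
    pick u v u≢v with G-complete u v u≢v
    ... | i , inj₁ p = out i , trans (R-out i u v) p
    ... | i , inj₂ p = inn i , trans (R-inn i u v) p

    G-lab : Fin n → Fin n → Maybe (Fin (ℓ + ℓ))
    G-lab u v with u ≟ v
    ... | yes _  = nothing
    ... | no u≢v = just (proj₁ (pick u v u≢v))

    graph : PGraph n
    graph = record { lab = G-lab ; loopless = G-loopless ; lab-inv = G-lab-inv }
      where
      G-loopless : ∀ v → G-lab v v ≡ nothing
      G-loopless v with v ≟ v
      ... | yes _  = refl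
      ... | no v≢v = contradiction refl v≢v

      G-lab-inv : ∀ u v → G-lab v u ≡ Maybe.map inv (G-lab u v)
      G-lab-inv u v with u ≟ v | v ≟ u
      ... | yes _   | yes _   = refl
      ... | yes u≡v | no v≢u  = contradiction (sym u≡v) v≢u
      ... | no u≢v  | yes v≡u = contradiction (sym v≡u) u≢v
      ... | no u≢v  | no v≢u  = cong just (R-unique _ _ v u (proj₂ (pick v u v≢u))
                                  (trans (R-inv (proj₁ (pick u v u≢v)) u v) (proj₂ (pick u v u≢v))))

    graph-total : ∀ u v → u ≢ v → Σ (Fin (ℓ + ℓ)) λ t → G-lab u v ≡ just t
    graph-total u v u≢v with u ≟ v
    ... | yes u≡v = contradiction u≡v u≢v
    ... | no _    = _ , refl

    has-R : ∀ t u v → has t (G-lab u v) ≡ 𝟏 (R t u v)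
    has-R t u v with u ≟ v
    ... | yes refl = cong 𝟏 (sym (R-irrefl t v))
    ... | no u≢v with pick u v u≢v | R t u v in e
    ...   | s , p | true  = trans (cong (λ x → δ x t) (R-unique s t u v p e)) (δ-refl t)
    ...   | s , p | false = δ-≢ λ s≡t → contradiction (trans (sym p) (trans (cong (λ x → R x u v) s≡t) e)) λ ()

    deg≡out-deg : ∀ i v → deg graph (out i) v ≡ out-deg G i v
    deg≡out-deg i v = trans (∑-cong λ w → trans (has-R (out i) v w) (cong 𝟏 (R-out i v w))) (sym (count≡∑ _))

    deg≡in-deg : ∀ i v → deg graph (inn i) v ≡ in-deg G i v
    deg≡in-deg i v = trans (∑-cong λ w → trans (has-R (inn i) v w) (cong 𝟏 (R-inn i v w))) (sym (count≡∑ _))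

  toDigraph : ∀ {N} → Exists initial N → ExistsCompleteRegular C D N
  toDigraph (n , part , counts , H , H-total , H-sat) = n , digraph , digraph-complete , part ,
    (λ j → trans (count≡∑ _) (counts j)) ,
    (λ i v → subst₂ _≐_ (sym (in-deg≡deg i v)) (bound-inn (part v) i) (Sat⇒≐ (bound (part v) (inn i)) (H-sat (inn i) v)) ,
             subst₂ _≐_ (sym (out-deg≡deg i v)) (bound-out (part v) i) (Sat⇒≐ (bound (part v) (out i)) (H-sat (out i) v)))
    where open ToDigraph H H-total

  fromDigraph : ∀ {N} → ExistsCompleteRegular C D N → Exists initial N
  fromDigraph (n , G , G-complete , part , counts , degrees) =
    n , part , (λ j → trans (sym (count≡∑ _)) (counts j)) , graph , graph-total , sat
    where
    open FromDigraph G G-complete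

    sat : ∀ t v → Sat (isBig (bound (part v) t)) (value (bound (part v) t)) (deg graph t v)
    sat t v with labelView t
    ... | is-out i = ≐⇒Sat (bound (part v) (out i))
      (subst₂ _≐_ (sym (deg≡out-deg i v)) (sym (bound-out (part v) i)) (proj₂ (degrees i v)))
    ... | is-inn i = ≐⇒Sat (bound (part v) (inn i))
      (subst₂ _≐_ (sym (deg≡in-deg i v)) (sym (bound-inn (part v) i)) (proj₁ (degrees i v)))

  comp-reg : Σ (Formula m) λ φ → ∀ N → ExistsCompleteRegular C D N ⇔ ⟦ φ ⟧ N
  comp-reg = proj₁ (definable initial) , λ N →
    mk⇔ (proj₁ (proj₂ (definable initial) N) ∘ fromDigraph) (toDigraph ∘ proj₂ (proj₂ (definable initial) N))

theorem6 : (ℓ m : ℕ) (C D : Fin ℓ → Fin m → 𝔹) →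
    Σ (Formula m) λ COMP-REG →
    (N : Fin m → ℕ) → ExistsCompleteRegular C D N ⇔ ⟦ COMP-REG ⟧ N
theorem6 ℓ m C D = Digraphs.comp-reg ℓ m C D
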